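{- Let $\Gamma\vdash t:A$ be a derivable typing judgement of the annotated language. Then there is a unique $u$ (up to renaming of bound variables) such that $\Gamma\vdash_e u:A$ and $[\![t]\!]=[\![u]\!]$, where $[\![-]\!]$ denotes the interpretation in the model $\mathsf{Circ}$.
   Context: Fix a set $\mathbf{Q}$ of qubits and a set $\mathbf{G}$ of gates; each gate $G$ comes with a tuple $(q_1,\dots,q_n)$ of distinct qubits and a duration $d_G\in\mathbb{R}_{\ge0}$; write $(G,d_G,q_1,\dots,q_n)\in\mathbf{G}$. **Annotated language.** Types: $A,B::=1\mid q\mid A\otimes B\mid \Box_d A$ ($q\in\mathbf{Q}$, $d\in\mathbb{R}$). Contexts: lists of graded declarations $x:^d A$ with distinct variables, $d\in\mathbb{R}$. $d+\Gamma$ adds $d$ to every grade of $\Gamma$. Typing rules: - Swap: from $\Gamma,x:^dA,y:^eB,\Delta\vdash t:C$ infer $\Gamma,y:^eB,x:^dA,\Delta\vdash t:C$. - Var: $x:^0A\vdash x:A$. Unit-I: $\vdash *:1$. - Unit-E: from $\Gamma\vdash s:1$, $\Delta\vdash t:A$ infer $d+\Gamma,\Delta\vdash\mathrm{let}\ *=s\ \mathrm{in}\ t:A$ ($d$ any real). - Gate: for $(G,d,q_1,\dots,q_n)\in\mathbf{G}$, from $\Gamma_i\vdash t_i:q_i$ infer $-d+\Gamma_1,\dots,-d+\Gamma_n\vdash G(t_1,\dots,t_n):q_1\otimes\cdots\otimes q_n$. - Tens-I: from $\Gamma\vdash s:A$, $\Delta\vdash t:B$ infer $\Gamma,\Delta\vdash(s,t):A\otimes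 B$. - Tens-E: from $\Gamma\vdash s:A\otimes B$ and $x:^dA,y:^dB,\Delta\vdash t:C$ infer $d+\Gamma,\Delta\vdash\mathrm{let}\ (x,y)=s\ \mathrm{in}\ t:C$. - Box-I: from $\Gamma\vdash t:A$ infer $d+\Gamma\vdash\mathrm{box}\ d\ t:\Box_dA$. - Box-E: from $\Gamma\vdash s:\Box_dA$ and $x:^eA,\Delta\vdash t:B$ infer $(e-d)+\Gamma,\Delta\vdash\mathrm{let\ box}\ d\ x=s\ \mathrm{in}\ t:B$. - Delay: from $\Gamma\vdash t:q$, $d\ge0$ infer $-d+\Gamma\vdash\mathrm{delay}_d(t):q$. - Let: from $\Gamma\vdash s:A$ and $x:^dA,\Delta\vdash t:C$ infer $d+\Gamma,\Delta\vdash\mathrm{let}\ x=s\ \mathrm{in}\ t:C$. **The category $\mathsf{Circ}$.** The strict symmetric monoidal category freely generated as follows. Objects are finite sequences of elements of $\mathbb{R}\times\mathbf{Q}$ (equivalently, contexts all of whose types are qubits, forgetting variable names), with tensor given by concatenation and unit the empty sequence. Morphisms are generated under composition and tensor by permutations (the symmetries), delays $\mathrm{delay}_d:[(x,q)]\to[(x+d,q)]$ for $q\in\mathbf{Q}$, $x\in\mathbb{R}$, $d\ge0$, and gates $\phi_G:[(x,q_1),\dots,(x,q_n)]\to[(x+d,q_1),\dots,(x+d,q_n)]$ for $(G,d,q_1,\dots,q_n)\in\mathbf{G}$, $x\in\mathbb{R}$, subject only to the axioms of strict symmetric monoidal categories. $\mathrm{Shift}(d)$ is the strict symmetric monoidal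 endofunctor adding $d$ to every time, fixing permutations and sending delays and gates to the correspondingly shifted ones. Write $\Gamma\multimap_G\Delta$ for its homsets. Each morphism has an underlying permutation matching positions of its source with positions of its target (delays and gates act as the identity permutation); accordingly, for a morphism $c:\Theta\multimap_G\Delta$ between qubit-only contexts, the variable names of $\Delta$ are those of $\Theta$, transported along this permutation. **Interpretation in $\mathsf{Circ}$.** $[\![1]\!]=[]$, $[\![q]\!]=[(0,q)]$, $[\![A\otimes B]\!]$ is the concatenation of $[\![A]\!]$ and $[\![B]\!]$, $[\![\Box_dA]\!]=\mathrm{Shift}(d)[\![A]\!]$; $[\![x_1:^{d_1}A_1,\dots,x_n:^{d_n}A_n]\!]$ is the concatenation of the $\mathrm{Shift}(d_i)[\![A_i]\!]$, so $[\![d+\Gamma]\!]=\mathrm{Shift}(d)[\![\Gamma]\!]$. A derivation of $\Gamma\vdash t:A$ is interpreted as a morphism $[\![t]\!]:[\![\Gamma]\!]\multimap_G[\![A]\!]$: Swap is precomposition with the symmetry; Var and Unit-I are identities; Unit-E is $\mathrm{Shift}(d)[\![s]\!]\otimes[\![t]\!]$; Tens-I is $[\![s]\!]\otimes[\![t]\!]$; Tens-E and Let are $[\![t]\!]\circ(\mathrm{Shift}(d)[\![s]\!]\otimes\mathrm{id})$; Gate is $\phi_G\circ\mathrm{Shift}(-d)(\bigotimes_i[\![t_i]\!])$ (with $\phi_G$ starting at time $-d$); Delay is $\mathrm{delay}_d\circ\mathrm{Shift}(-d)[\![t]\!]$ (starting at time $-d$); Box-I is $\mathrm{Shift}(d)[\![t]\!]$;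 Box-E is $[\![t]\!]\circ(\mathrm{Shift}(e-d)[\![s]\!]\otimes\mathrm{id})$. **Normal forms.** The judgements $\Gamma\vdash_n t:A$ and $\Gamma\vdash_e t:A$ are generated by the following rules, where $\Theta$ always denotes a context containing only qubit types (so eliminators act only on the first non-qubit variable): - $\vdash_n *:1$; $x:^0q\vdash_n x:q$ for $q\in\mathbf{Q}$; from $\Gamma\vdash_n s:A$, $\Delta\vdash_n t:B$ infer $\Gamma,\Delta\vdash_n(s,t):A\otimes B$; from $\Gamma\vdash_n t:A$ infer $d+\Gamma\vdash_n\mathrm{box}\ d\ t:\Box_dA$. - from $\Theta,\Delta\vdash_e t:A$ infer $\Theta,x:^d1,\Delta\vdash_e\mathrm{let}\ *=x\ \mathrm{in}\ t:A$. - from $\Theta,x:^dA,y:^dB,\Delta\vdash_e t:C$ infer $\Theta,z:^d(A\otimes B),\Delta\vdash_e\mathrm{let}\ (x,y)=z\ \mathrm{in}\ t:C$. - from $\Theta,x:^{d+e}A,\Delta\vdash_e t:B$ infer $\Theta,z:^d\Box_eA,\Delta\vdash_e\mathrm{let\ box}\ e\ x=z\ \mathrm{in}\ t:B$. - Circ: from $\Delta\vdash_n t:B$ and a morphism $c:\Theta\multimap_G\Delta$ of $\mathsf{Circ}$ infer $\Theta\vdash_e t\ \mathsf{after}\ c:B$. All these terms are interpreted in $\mathsf{Circ}$ as in the annotated language, with $[\![t\ \mathsf{after}\ c]\!]:=[\![t]\!]\circ c$. -}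

module Defs where

open import Algebra.Structures using (IsAbelianGroup)
open import Data.List.Base using (List; []; _∷_; _++_; map)
open import Data.List.Properties using (++-assoc; ++-identityʳ; map-++; map-∘; map-cong; map-id)
open import Data.List.Relation.Binary.Pointwise using (Pointwise)
open import Data.List.Relation.Unary.All using (All; []; _∷_)
import Data.List.Relation.Unary.All.Properties as All
open import Data.List.Relation.Unary.Unique.Propositional using (Unique)
open import Data.Nat.Base using (ℕ)
open import Data.Product.Base using (_×_; _,_)
open import Relation.Binary.PropositionalEquality
  using (_≡_; _≢_; refl; sym; trans; cong; cong₂; module ≡-Reasoning)
open import Relation.Binary.Structures using (IsPartialOrder)

-- Times, grades and durations are the real numbers, which enter only through
-- their ordered additive group.  Constructions of the reals come with a setoid
-- equality rather than _≡_, so ℝ stands for an arbitrary ordered abelian group;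
-- the real numbers are the intended instance.

record OrderedAbelianGroup : Set₁ where
  infixl 6 _+_ _-_
  infix  8 -_
  infix  4 _≤_
  field
    ℝ              : Set
    _+_            : ℝ → ℝ → ℝ
    0#             : ℝ
    -_             : ℝ → ℝ
    _≤_            : ℝ → ℝ → Set
    isAbelianGroup : IsAbelianGroup _≡_ _+_ 0# -_
    isPartialOrder : IsPartialOrder _≡_ _≤_
    +-monoʳ-≤      : ∀ x {y z} → y ≤ z → x + y ≤ x + z

  _-_ : ℝ → ℝ → ℝ
  x - y = x + (- y)

  open IsAbelianGroup isAbelianGroup public
    using (assoc; comm; identityˡ; identityʳ; inverseˡ; inverseʳ)

record Signature (R : OrderedAbelianGroup) : Set₁ where
  open OrderedAbelianGroup R
  field
    Qubit           : Set
    Gate            : Set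
    qubits          : Gate → List Qubit
    qubits-distinct : ∀ G → Unique (qubits G)
    duration        : Gate → ℝ
    duration≥0      : ∀ G → 0# ≤ duration G

module Circuits (R : OrderedAbelianGroup) (S : Signature R) where

  open OrderedAbelianGroup R
  open Signature S

  Obj : Set
  Obj = List (ℝ × Qubit)

  -- All the given qubits, at the same time x.
  at : ℝ → List Qubit → Obj
  at x = map (x ,_)

  infix  4 _⊸_
  infixr 7 _⊗_
  infixr 6 _∘_

  -- Representatives of morphisms; the morphisms of Circ are these up to _≈_.
  -- The nonnegativity proof is irrelevant, so that a delay is determined by d, x, q.
  data _⊸_ : Obj → Obj → Set where
    id    : ∀ a → a ⊸ a
    _∘_   : ∀ {a b c} → b ⊸ c → a ⊸ b → a ⊸ c
    _⊗_   : ∀ {a b a′ b′} → a ⊸ b → a′ ⊸ b′ → a ++ a′ ⊸ b ++ b′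
    σ     : ∀ a b → a ++ b ⊸ b ++ a
    delay : ∀ d → .(0# ≤ d) → ∀ x q → (x , q) ∷ [] ⊸ (x + d , q) ∷ []
    φ     : ∀ G x → at x (qubits G) ⊸ at (x + duration G) (qubits G)

  cast : ∀ {a a′ b b′} → a ≡ a′ → b ≡ b′ → a ⊸ b → a′ ⊸ b′
  cast refl refl f = f

  infix 4 _≈_

  -- Equality of morphisms: the congruence generated by the axioms of strict
  -- symmetric monoidal categories.  Strict associativity and unitality equate
  -- objects that are only propositionally equal as lists, so the relation is
  -- heterogeneous in source and target (f ≈ g forces these to be equal).
  data _≈_ : ∀ {a b a′ b′} → a ⊸ b → a′ ⊸ b′ → Set where
    ≈-refl  : ∀ {a b} {f : a ⊸ b} → f ≈ f
    ≈-sym   : ∀ {a b a′ b′} {f : a ⊸ b} {g : a′ ⊸ b′} → f ≈ g → g ≈ f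
    ≈-trans : ∀ {a b a′ b′ a″ b″} {f : a ⊸ b} {g : a′ ⊸ b′} {h : a″ ⊸ b″} →
              f ≈ g → g ≈ h → f ≈ h
    ∘-cong  : ∀ {a b c a′ b′ c′} {f : b ⊸ c} {f′ : b′ ⊸ c′} {g : a ⊸ b} {g′ : a′ ⊸ b′} →
              f ≈ f′ → g ≈ g′ → f ∘ g ≈ f′ ∘ g′
    ⊗-cong  : ∀ {a b c d a′ b′ c′ d′}
              {f : a ⊸ b} {f′ : a′ ⊸ b′} {g : c ⊸ d} {g′ : c′ ⊸ d′} →
              f ≈ f′ → g ≈ g′ → f ⊗ g ≈ f′ ⊗ g′

    ∘-identityˡ : ∀ {a b} {f : a ⊸ b} → id b ∘ f ≈ f
    ∘-identityʳ : ∀ {a b} {f : a ⊸ b} → f ∘ id a ≈ f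
    ∘-assoc     : ∀ {a b c d} {f : c ⊸ d} {g : b ⊸ c} {h : a ⊸ b} →
                  (f ∘ g) ∘ h ≈ f ∘ (g ∘ h)

    ⊗-id        : ∀ {a b} → id a ⊗ id b ≈ id (a ++ b)
    interchange : ∀ {a b c a′ b′ c′}
                  {f : b ⊸ c} {g : a ⊸ b} {f′ : b′ ⊸ c′} {g′ : a′ ⊸ b′} →
                  (f ∘ g) ⊗ (f′ ∘ g′) ≈ (f ⊗ f′) ∘ (g ⊗ g′)
    ⊗-identityˡ : ∀ {a b} {f : a ⊸ b} → id [] ⊗ f ≈ f
    ⊗-identityʳ : ∀ {a b} {f : a ⊸ b} → f ⊗ id [] ≈ f
    ⊗-assoc     : ∀ {a b c a′ b′ c′} {f : a ⊸ a′} {g : b ⊸ b′} {h : c ⊸ c′} →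
                  (f ⊗ g) ⊗ h ≈ f ⊗ (g ⊗ h)

    σ-natural    : ∀ {a b a′ b′} {f : a ⊸ a′} {g : b ⊸ b′} →
                   σ a′ b′ ∘ (f ⊗ g) ≈ (g ⊗ f) ∘ σ a b
    σ-involutive : ∀ {a b} → σ b a ∘ σ a b ≈ id (a ++ b)
    σ-unit       : ∀ {a} → σ a [] ≈ id a
    σ-hexagon    : ∀ {a b c} →
                   σ a (b ++ c) ≈
                   (id b ⊗ σ a c) ∘ cast refl (++-assoc b a c) (σ a b ⊗ id c)

  shift : ℝ → Obj → Obj
  shift d = map λ (x , q) → d + x , q

  shift-++ : ∀ d a b → shift d (a ++ b) ≡ shift d a ++ shift d b
  shift-++ d = map-++ _

  shift-0 : ∀ a → shift 0# a ≡ a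
  shift-0 a = trans (map-cong (λ (x , q) → cong (_, q) (identityˡ x)) a) (map-id a)

  shift-shift : ∀ d e a → shift d (shift e a) ≡ shift (d + e) a
  shift-shift d e a = trans (sym (map-∘ a))
    (map-cong (λ (x , q) → cong (_, q) (sym (assoc d e x))) a)

  shift-at : ∀ d x qs → shift d (at x qs) ≡ at (d + x) qs
  shift-at d x qs = sym (map-∘ qs)

  Shift : ∀ d {a b} → a ⊸ b → shift d a ⊸ shift d b
  Shift d (id a)  = id (shift d a)
  Shift d (f ∘ g) = Shift d f ∘ Shift d g
  Shift d (_⊗_ {a} {b} {a′} {b′} f g) =
    cast (sym (shift-++ d a a′)) (sym (shift-++ d b b′)) (Shift d f ⊗ Shift d g)
  Shift d (σ a b) =
    cast (sym (shift-++ d a b)) (sym (shift-++ d b a)) (σ (shift d a) (shift d b))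
  Shift d (delay e e≥0 x q) =
    cast refl (cong (λ y → (y , q) ∷ []) (assoc d x e)) (delay e e≥0 (d + x) q)
  Shift d (φ G x) =
    cast (sym (shift-at d x (qubits G)))
         (trans (cong (λ y → at y (qubits G)) (assoc d x (duration G)))
                (sym (shift-at d (x + duration G) (qubits G))))
         (φ G (d + x))

  -- One label for each position of an object.
  Labelling : Set → Obj → Set
  Labelling X = All (λ _ → X)

  -- The action of the underlying permutation of a morphism: each label moves
  -- from its position in the source to the matching position in the target.
  transport : ∀ {X a b} → a ⊸ b → Labelling X a → Labelling X b
  transport (id a)          xs       = xs
  transport (f ∘ g)         xs       = transport f (transport g xs)
  transport (_⊗_ {a} f g)   xs       with ys , zs ← All.++⁻ a xs =
    All.++⁺ (transport f ys) (transport g zs)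
  transport (σ a b)         xs       with ys , zs ← All.++⁻ a xs = All.++⁺ zs ys
  transport (delay _ _ _ _) (x ∷ []) = x ∷ []
  transport (φ G x)         xs       = All.map⁺ (All.map⁻ xs)

module Language (R : OrderedAbelianGroup) (S : Signature R) where

  open OrderedAbelianGroup R
  open Signature S
  open Circuits R S public

  Name : Set
  Name = ℕ

  infixr 7 _⊠_

  data Type : Set where
    𝟙     : Type
    qubit : Qubit → Type
    _⊠_   : Type → Type → Type
    □     : ℝ → Type → Type

  -- q₁ ⊗ ⋯ ⊗ qₙ, without a trailing unit when n ≥ 1.
  ⨂ : List Qubit → Type
  ⨂ []               = 𝟙
  ⨂ (q ∷ [])         = qubit q
  ⨂ (q ∷ qs@(_ ∷ _)) = qubit q ⊠ ⨂ qs

  infix 5 _∶⟨_⟩_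

  record Decl : Set where
    constructor _∶⟨_⟩_
    field
      name  : Name
      grade : ℝ
      type  : Type
  open Decl

  Ctx : Set
  Ctx = List Decl

  Distinct : Ctx → Set
  Distinct Γ = Unique (map name Γ)

  infixr 6 _+ᶜ_

  _+ᶜ_ : ℝ → Ctx → Ctx
  d +ᶜ Γ = map (λ (x ∶⟨ e ⟩ A) → x ∶⟨ d + e ⟩ A) Γ

  -- The qubit-only context with underlying object a and variables xs.
  qubitCtx : (a : Obj) → Labelling Name a → Ctx
  qubitCtx []            []       = []
  qubitCtx ((d , q) ∷ a) (x ∷ xs) = (x ∶⟨ d ⟩ qubit q) ∷ qubitCtx a xs

  data Term : Set where
    var     : Name → Term
    ⋆       : Term
    let⋆    : (s t : Term) → Term                  -- let * = s in t
    gate    : Gate → List Term → Term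
    pair    : (s t : Term) → Term
    letpair : (x y : Name) (s t : Term) → Term      -- let (x , y) = s in t
    box     : ℝ → Term → Term
    letbox  : ℝ → (x : Name) (s t : Term) → Term    -- let box d x = s in t
    delay   : ℝ → Term → Term
    letvar  : (x : Name) (s t : Term) → Term        -- let x = s in t
    _after_ : ∀ {a b} → Term → a ⊸ b → Term        -- occurs in normal forms only

  -- Renaming of bound variables.  ρ ⊢ x ~ y says that x and y are bound by
  -- corresponding binders, the innermost binders being first in ρ, or are the
  -- same free variable.

  Renaming : Set
  Renaming = List (Name × Name)

  infix 4 _⊢_~_ _⊢_≈α_ _≈α_

  data _⊢_~_ : Renaming → Name → Name → Set where
    free  : ∀ {x} → [] ⊢ x ~ x
    here  : ∀ {ρ x y} → (x , y) ∷ ρ ⊢ x ~ y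
    there : ∀ {ρ x y x′ y′} → x ≢ x′ → y ≢ y′ → ρ ⊢ x ~ y → (x′ , y′) ∷ ρ ⊢ x ~ y

  data _⊢_≈α_ (ρ : Renaming) : Term → Term → Set where
    var     : ∀ {x x′} → ρ ⊢ x ~ x′ → ρ ⊢ var x ≈α var x′
    ⋆       : ρ ⊢ ⋆ ≈α ⋆
    let⋆    : ∀ {s s′ t t′} → ρ ⊢ s ≈α s′ → ρ ⊢ t ≈α t′ → ρ ⊢ let⋆ s t ≈α let⋆ s′ t′
    gate    : ∀ {G ts ts′} → Pointwise (ρ ⊢_≈α_) ts ts′ → ρ ⊢ gate G ts ≈α gate G ts′
    pair    : ∀ {s s′ t t′} → ρ ⊢ s ≈α s′ → ρ ⊢ t ≈α t′ → ρ ⊢ pair s t ≈α pair s′ t′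
    letpair : ∀ {x x′ y y′ s s′ t t′} →
              ρ ⊢ s ≈α s′ → (y , y′) ∷ (x , x′) ∷ ρ ⊢ t ≈α t′ →
              ρ ⊢ letpair x y s t ≈α letpair x′ y′ s′ t′
    box     : ∀ {d t t′} → ρ ⊢ t ≈α t′ → ρ ⊢ box d t ≈α box d t′
    letbox  : ∀ {d x x′ s s′ t t′} →
              ρ ⊢ s ≈α s′ → (x , x′) ∷ ρ ⊢ t ≈α t′ →
              ρ ⊢ letbox d x s t ≈α letbox d x′ s′ t′
    delay   : ∀ {d t t′} → ρ ⊢ t ≈α t′ → ρ ⊢ delay d t ≈α delay d t′
    letvar  : ∀ {x x′ s s′ t t′} →
              ρ ⊢ s ≈α s′ → (x , x′) ∷ ρ ⊢ t ≈α t′ →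
              ρ ⊢ letvar x s t ≈α letvar x′ s′ t′
    _after_ : ∀ {a b a′ b′ t t′} {c : a ⊸ b} {c′ : a′ ⊸ b′} →
              ρ ⊢ t ≈α t′ → c ≈ c′ → ρ ⊢ t after c ≈α t′ after c′

  _≈α_ : Term → Term → Set
  t ≈α u = [] ⊢ t ≈α u

  infix 4 _⊢_∶_ _⊢*_∶_ _⊢ₙ_∶_ _⊢ₑ_∶_

  -- The Distinct premises implement the convention that the variables of a
  -- context are distinct: they hold of the context of every derivable judgement.
  mutual
    data _⊢_∶_ : Ctx → Term → Type → Set where
      Swap   : ∀ {Γ Δ x y d e A B C t} →
               Γ ++ (x ∶⟨ d ⟩ A) ∷ (y ∶⟨ e ⟩ B) ∷ Δ ⊢ t ∶ C →
               Γ ++ (y ∶⟨ e ⟩ B) ∷ (x ∶⟨ d ⟩ A) ∷ Δ ⊢ t ∶ C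
      Var    : ∀ {x A} → (x ∶⟨ 0# ⟩ A) ∷ [] ⊢ var x ∶ A
      Unit-I : [] ⊢ ⋆ ∶ 𝟙
      Unit-E : ∀ {Γ Δ s t A} d → Distinct (d +ᶜ Γ ++ Δ) →
               Γ ⊢ s ∶ 𝟙 → Δ ⊢ t ∶ A →
               d +ᶜ Γ ++ Δ ⊢ let⋆ s t ∶ A
      Gate-I : ∀ {Γ ts} G → Distinct Γ →
               Γ ⊢* ts ∶ qubits G →
               (- duration G) +ᶜ Γ ⊢ gate G ts ∶ ⨂ (qubits G)
      Tens-I : ∀ {Γ Δ s t A B} → Distinct (Γ ++ Δ) →
               Γ ⊢ s ∶ A → Δ ⊢ t ∶ B →
               Γ ++ Δ ⊢ pair s t ∶ A ⊠ B
      Tens-E : ∀ {Γ Δ x y d s t A B C} → Distinct (d +ᶜ Γ ++ Δ) →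
               Γ ⊢ s ∶ A ⊠ B → (x ∶⟨ d ⟩ A) ∷ (y ∶⟨ d ⟩ B) ∷ Δ ⊢ t ∶ C →
               d +ᶜ Γ ++ Δ ⊢ letpair x y s t ∶ C
      Box-I  : ∀ {Γ t A} d →
               Γ ⊢ t ∶ A →
               d +ᶜ Γ ⊢ box d t ∶ □ d A
      Box-E  : ∀ {Γ Δ x d e s t A B} → Distinct ((e - d) +ᶜ Γ ++ Δ) →
               Γ ⊢ s ∶ □ d A → (x ∶⟨ e ⟩ A) ∷ Δ ⊢ t ∶ B →
               (e - d) +ᶜ Γ ++ Δ ⊢ letbox d x s t ∶ B
      Delay  : ∀ {Γ t q} d → 0# ≤ d →
               Γ ⊢ t ∶ qubit q →
               (- d) +ᶜ Γ ⊢ delay d t ∶ qubit q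
      Let    : ∀ {Γ Δ x d s t A C} → Distinct (d +ᶜ Γ ++ Δ) →
               Γ ⊢ s ∶ A → (x ∶⟨ d ⟩ A) ∷ Δ ⊢ t ∶ C →
               d +ᶜ Γ ++ Δ ⊢ letvar x s t ∶ C

    -- Γ₁ , … , Γₙ ⊢* t₁ , … , tₙ ∶ q₁ , … , qₙ  when  Γᵢ ⊢ tᵢ ∶ qᵢ  for all i.
    data _⊢*_∶_ : Ctx → List Term → List Qubit → Set where
      []  : [] ⊢* [] ∶ []
      _∷_ : ∀ {Γ Δ t ts q qs} →
            Γ ⊢ t ∶ qubit q → Δ ⊢* ts ∶ qs →
            Γ ++ Δ ⊢* t ∷ ts ∶ q ∷ qs

  data _⊢ₙ_∶_ : Ctx → Term → Type → Set where
    Unit : [] ⊢ₙ ⋆ ∶ 𝟙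
    Var  : ∀ {x q} → (x ∶⟨ 0# ⟩ qubit q) ∷ [] ⊢ₙ var x ∶ qubit q
    Tens : ∀ {Γ Δ s t A B} → Distinct (Γ ++ Δ) →
           Γ ⊢ₙ s ∶ A → Δ ⊢ₙ t ∶ B →
           Γ ++ Δ ⊢ₙ pair s t ∶ A ⊠ B
    Box  : ∀ {Γ t A} d →
           Γ ⊢ₙ t ∶ A →
           d +ᶜ Γ ⊢ₙ box d t ∶ □ d A

  -- The qubit-only contexts Θ are the qubitCtx a xs.
  data _⊢ₑ_∶_ : Ctx → Term → Type → Set where
    Unit : ∀ a xs {Δ x d t A} → let Θ = qubitCtx a xs in
           Distinct (Θ ++ (x ∶⟨ d ⟩ 𝟙) ∷ Δ) →
           Θ ++ Δ ⊢ₑ t ∶ A →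
           Θ ++ (x ∶⟨ d ⟩ 𝟙) ∷ Δ ⊢ₑ let⋆ (var x) t ∶ A
    Tens : ∀ a xs {Δ x y z d t A B C} → let Θ = qubitCtx a xs in
           Distinct (Θ ++ (z ∶⟨ d ⟩ A ⊠ B) ∷ Δ) →
           Θ ++ (x ∶⟨ d ⟩ A) ∷ (y ∶⟨ d ⟩ B) ∷ Δ ⊢ₑ t ∶ C →
           Θ ++ (z ∶⟨ d ⟩ A ⊠ B) ∷ Δ ⊢ₑ letpair x y (var z) t ∶ C
    Box  : ∀ a xs {Δ x z d e t A B} → let Θ = qubitCtx a xs in
           Distinct (Θ ++ (z ∶⟨ d ⟩ □ e A) ∷ Δ) →
           Θ ++ (x ∶⟨ d + e ⟩ A) ∷ Δ ⊢ₑ t ∶ B →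
           Θ ++ (z ∶⟨ d ⟩ □ e A) ∷ Δ ⊢ₑ letbox e x (var z) t ∶ B
    Circ : ∀ {a b xs t B} (c : a ⊸ b) →
           Distinct (qubitCtx a xs) →
           qubitCtx b (transport c xs) ⊢ₙ t ∶ B →
           qubitCtx a xs ⊢ₑ t after c ∶ B

  ⟦_⟧ᵀ : Type → Obj
  ⟦ 𝟙 ⟧ᵀ       = []
  ⟦ qubit q ⟧ᵀ = (0# , q) ∷ []
  ⟦ A ⊠ B ⟧ᵀ   = ⟦ A ⟧ᵀ ++ ⟦ B ⟧ᵀ
  ⟦ □ d A ⟧ᵀ   = shift d ⟦ A ⟧ᵀ

  ⟦_⟧ᶜ : Ctx → Obj
  ⟦ [] ⟧ᶜ              = []
  ⟦ (x ∶⟨ d ⟩ A) ∷ Γ ⟧ᶜ = shift d ⟦ A ⟧ᵀ ++ ⟦ Γ ⟧ᶜ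

  ⟦++⟧ : ∀ Γ Δ → ⟦ Γ ++ Δ ⟧ᶜ ≡ ⟦ Γ ⟧ᶜ ++ ⟦ Δ ⟧ᶜ
  ⟦++⟧ []                  Δ = refl
  ⟦++⟧ ((x ∶⟨ d ⟩ A) ∷ Γ) Δ =
    trans (cong (shift d ⟦ A ⟧ᵀ ++_) (⟦++⟧ Γ Δ)) (sym (++-assoc (shift d ⟦ A ⟧ᵀ) _ _))

  ⟦+ᶜ⟧ : ∀ d Γ → ⟦ d +ᶜ Γ ⟧ᶜ ≡ shift d ⟦ Γ ⟧ᶜ
  ⟦+ᶜ⟧ d []                  = refl
  ⟦+ᶜ⟧ d ((x ∶⟨ e ⟩ A) ∷ Γ) =
    trans (cong₂ _++_ (sym (shift-shift d e ⟦ A ⟧ᵀ)) (⟦+ᶜ⟧ d Γ))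
          (sym (shift-++ d (shift e ⟦ A ⟧ᵀ) ⟦ Γ ⟧ᶜ))

  ⟦+ᶜ++⟧ : ∀ d Γ Δ → ⟦ d +ᶜ Γ ++ Δ ⟧ᶜ ≡ shift d ⟦ Γ ⟧ᶜ ++ ⟦ Δ ⟧ᶜ
  ⟦+ᶜ++⟧ d Γ Δ = trans (⟦++⟧ (d +ᶜ Γ) Δ) (cong (_++ ⟦ Δ ⟧ᶜ) (⟦+ᶜ⟧ d Γ))

  ⟦⨂⟧ : ∀ qs → ⟦ ⨂ qs ⟧ᵀ ≡ at 0# qs
  ⟦⨂⟧ []               = refl
  ⟦⨂⟧ (q ∷ [])         = refl
  ⟦⨂⟧ (q ∷ qs@(_ ∷ _)) = cong ((0# , q) ∷_) (⟦⨂⟧ qs)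

  ⟦qubitCtx⟧ : ∀ a xs → ⟦ qubitCtx a xs ⟧ᶜ ≡ a
  ⟦qubitCtx⟧ []            []       = refl
  ⟦qubitCtx⟧ ((d , q) ∷ a) (x ∷ xs) =
    cong₂ (λ e b → (e , q) ∷ b) (identityʳ d) (⟦qubitCtx⟧ a xs)

  ⟦exchange⟧ : ∀ Γ Φ Ψ Δ →
               ⟦ Γ ⟧ᶜ ++ (⟦ Φ ⟧ᶜ ++ ⟦ Ψ ⟧ᶜ) ++ ⟦ Δ ⟧ᶜ ≡ ⟦ Γ ++ Φ ++ Ψ ++ Δ ⟧ᶜ
  ⟦exchange⟧ Γ Φ Ψ Δ = begin
    ⟦ Γ ⟧ᶜ ++ (⟦ Φ ⟧ᶜ ++ ⟦ Ψ ⟧ᶜ) ++ ⟦ Δ ⟧ᶜ  ≡⟨ cong (⟦ Γ ⟧ᶜ ++_) (++-assoc ⟦ Φ ⟧ᶜ _ _) ⟩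
    ⟦ Γ ⟧ᶜ ++ ⟦ Φ ⟧ᶜ ++ ⟦ Ψ ⟧ᶜ ++ ⟦ Δ ⟧ᶜ    ≡⟨ cong (λ a → ⟦ Γ ⟧ᶜ ++ ⟦ Φ ⟧ᶜ ++ a) (⟦++⟧ Ψ Δ) ⟨
    ⟦ Γ ⟧ᶜ ++ ⟦ Φ ⟧ᶜ ++ ⟦ Ψ ++ Δ ⟧ᶜ          ≡⟨ cong (⟦ Γ ⟧ᶜ ++_) (⟦++⟧ Φ (Ψ ++ Δ)) ⟨
    ⟦ Γ ⟧ᶜ ++ ⟦ Φ ++ Ψ ++ Δ ⟧ᶜ                ≡⟨ ⟦++⟧ Γ (Φ ++ Ψ ++ Δ) ⟨
    ⟦ Γ ++ Φ ++ Ψ ++ Δ ⟧ᶜ                      ∎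
    where open ≡-Reasoning

  -- Interpretations of the rules, shared by the annotated language and the
  -- normal forms.

  exchange : ∀ Γ Φ Ψ Δ {b} → ⟦ Γ ++ Φ ++ Ψ ++ Δ ⟧ᶜ ⊸ b → ⟦ Γ ++ Ψ ++ Φ ++ Δ ⟧ᶜ ⊸ b
  exchange Γ Φ Ψ Δ f =
    f ∘ cast (⟦exchange⟧ Γ Ψ Φ Δ) (⟦exchange⟧ Γ Φ Ψ Δ)
             (id ⟦ Γ ⟧ᶜ ⊗ (σ ⟦ Ψ ⟧ᶜ ⟦ Φ ⟧ᶜ ⊗ id ⟦ Δ ⟧ᶜ))

  var-id : ∀ x A → ⟦ (x ∶⟨ 0# ⟩ A) ∷ [] ⟧ᶜ ⊸ ⟦ A ⟧ᵀ
  var-id x A = cast (sym (trans (++-identityʳ _) (shift-0 ⟦ A ⟧ᵀ))) refl (id ⟦ A ⟧ᵀ)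

  tensor : ∀ Γ Δ {b b′} → ⟦ Γ ⟧ᶜ ⊸ b → ⟦ Δ ⟧ᶜ ⊸ b′ → ⟦ Γ ++ Δ ⟧ᶜ ⊸ b ++ b′
  tensor Γ Δ f g = cast (sym (⟦++⟧ Γ Δ)) refl (f ⊗ g)

  shifted : ∀ d Γ {b} → ⟦ Γ ⟧ᶜ ⊸ b → ⟦ d +ᶜ Γ ⟧ᶜ ⊸ shift d b
  shifted d Γ f = cast (sym (⟦+ᶜ⟧ d Γ)) refl (Shift d f)

  unit-elim : ∀ d Γ Δ {b} → ⟦ Γ ⟧ᶜ ⊸ ⟦ 𝟙 ⟧ᵀ → ⟦ Δ ⟧ᶜ ⊸ b → ⟦ d +ᶜ Γ ++ Δ ⟧ᶜ ⊸ b
  unit-elim d Γ Δ s t = cast (sym (⟦+ᶜ++⟧ d Γ Δ)) refl (Shift d s ⊗ t)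

  let-elim : ∀ d Γ Δ x A {b} →
             ⟦ Γ ⟧ᶜ ⊸ ⟦ A ⟧ᵀ → ⟦ (x ∶⟨ d ⟩ A) ∷ Δ ⟧ᶜ ⊸ b → ⟦ d +ᶜ Γ ++ Δ ⟧ᶜ ⊸ b
  let-elim d Γ Δ x A s t =
    t ∘ cast (sym (⟦+ᶜ++⟧ d Γ Δ)) refl (Shift d s ⊗ id ⟦ Δ ⟧ᶜ)

  tens-elim : ∀ d Γ Δ x y A B {b} →
              ⟦ Γ ⟧ᶜ ⊸ ⟦ A ⊠ B ⟧ᵀ → ⟦ (x ∶⟨ d ⟩ A) ∷ (y ∶⟨ d ⟩ B) ∷ Δ ⟧ᶜ ⊸ b →
              ⟦ d +ᶜ Γ ++ Δ ⟧ᶜ ⊸ b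
  tens-elim d Γ Δ x y A B s t =
    t ∘ cast (sym (⟦+ᶜ++⟧ d Γ Δ))
             (trans (cong (_++ ⟦ Δ ⟧ᶜ) (shift-++ d ⟦ A ⟧ᵀ ⟦ B ⟧ᵀ)) (++-assoc (shift d ⟦ A ⟧ᵀ) _ _))
             (Shift d s ⊗ id ⟦ Δ ⟧ᶜ)

  e-d+d≡e : ∀ e d → (e - d) + d ≡ e
  e-d+d≡e e d = trans (assoc e (- d) d) (trans (cong (e +_) (inverseˡ d)) (identityʳ e))

  box-elim : ∀ d e Γ Δ x A {b} →
             ⟦ Γ ⟧ᶜ ⊸ ⟦ □ d A ⟧ᵀ → ⟦ (x ∶⟨ e ⟩ A) ∷ Δ ⟧ᶜ ⊸ b →
             ⟦ (e - d) +ᶜ Γ ++ Δ ⟧ᶜ ⊸ b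
  box-elim d e Γ Δ x A s t =
    t ∘ cast (sym (⟦+ᶜ++⟧ (e - d) Γ Δ))
             (cong (_++ ⟦ Δ ⟧ᶜ)
               (trans (shift-shift (e - d) d ⟦ A ⟧ᵀ) (cong (λ f → shift f ⟦ A ⟧ᵀ) (e-d+d≡e e d))))
             (Shift (e - d) s ⊗ id ⟦ Δ ⟧ᶜ)

  apply-delay : ∀ d → 0# ≤ d → ∀ Γ q → ⟦ Γ ⟧ᶜ ⊸ ⟦ qubit q ⟧ᵀ → ⟦ (- d) +ᶜ Γ ⟧ᶜ ⊸ ⟦ qubit q ⟧ᵀ
  apply-delay d d≥0 Γ q f =
    cast (cong (λ x → (x , q) ∷ []) (sym (identityʳ (- d))))
         (cong (λ x → (x , q) ∷ []) (inverseˡ d))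
         (delay d d≥0 (- d) q)
    ∘ shifted (- d) Γ f

  apply-gate : ∀ G Γ → ⟦ Γ ⟧ᶜ ⊸ at 0# (qubits G) →
               ⟦ (- duration G) +ᶜ Γ ⟧ᶜ ⊸ ⟦ ⨂ (qubits G) ⟧ᵀ
  apply-gate G Γ f =
    cast (sym (trans (shift-at (- d) 0# qs) (cong (λ x → at x qs) (identityʳ (- d)))))
         (trans (cong (λ x → at x qs) (inverseˡ d)) (sym (⟦⨂⟧ qs)))
         (φ G (- d))
    ∘ shifted (- d) Γ f
    where
    d  = duration G
    qs = qubits G

  mutual
    ⟦_⟧ : ∀ {Γ t A} → Γ ⊢ t ∶ A → ⟦ Γ ⟧ᶜ ⊸ ⟦ A ⟧ᵀ
    ⟦ Swap {Γ} {Δ} {x} {y} {d} {e} {A} {B} t ⟧ =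
      exchange Γ ((x ∶⟨ d ⟩ A) ∷ []) ((y ∶⟨ e ⟩ B) ∷ []) Δ ⟦ t ⟧
    ⟦ Var {x} {A} ⟧                                   = var-id x A
    ⟦ Unit-I ⟧                                        = id []
    ⟦ Unit-E {Γ} {Δ} d _ s t ⟧                        = unit-elim d Γ Δ ⟦ s ⟧ ⟦ t ⟧
    ⟦ Gate-I {Γ} G _ ts ⟧                             = apply-gate G Γ ⟦ ts ⟧*
    ⟦ Tens-I {Γ} {Δ} _ s t ⟧                          = tensor Γ Δ ⟦ s ⟧ ⟦ t ⟧
    ⟦ Tens-E {Γ} {Δ} {x} {y} {d} {A = A} {B} _ s t ⟧  = tens-elim d Γ Δ x y A B ⟦ s ⟧ ⟦ t ⟧
    ⟦ Box-I {Γ} d t ⟧                                 = shifted d Γ ⟦ t ⟧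
    ⟦ Box-E {Γ} {Δ} {x} {d} {e} {A = A} _ s t ⟧       = box-elim d e Γ Δ x A ⟦ s ⟧ ⟦ t ⟧
    ⟦ Delay {Γ} {q = q} d d≥0 t ⟧                     = apply-delay d d≥0 Γ q ⟦ t ⟧
    ⟦ Let {Γ} {Δ} {x} {d} {A = A} _ s t ⟧             = let-elim d Γ Δ x A ⟦ s ⟧ ⟦ t ⟧

    ⟦_⟧* : ∀ {Γ ts qs} → Γ ⊢* ts ∶ qs → ⟦ Γ ⟧ᶜ ⊸ at 0# qs
    ⟦ [] ⟧*                  = id []
    ⟦ _∷_ {Γ} {Δ} t ts ⟧*    = tensor Γ Δ ⟦ t ⟧ ⟦ ts ⟧*

  ⟦_⟧ₙ : ∀ {Γ t A} → Γ ⊢ₙ t ∶ A → ⟦ Γ ⟧ᶜ ⊸ ⟦ A ⟧ᵀ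
  ⟦ Unit ⟧ₙ               = id []
  ⟦ Var {x} {q} ⟧ₙ        = var-id x (qubit q)
  ⟦ Tens {Γ} {Δ} _ s t ⟧ₙ = tensor Γ Δ ⟦ s ⟧ₙ ⟦ t ⟧ₙ
  ⟦ Box {Γ} d t ⟧ₙ        = shifted d Γ ⟦ t ⟧ₙ

  regrade : ∀ {d e} z A Γ {b} → d ≡ e →
            ⟦ (z ∶⟨ d ⟩ A) ∷ Γ ⟧ᶜ ⊸ b → ⟦ (z ∶⟨ e ⟩ A) ∷ Γ ⟧ᶜ ⊸ b
  regrade z A Γ d≡e = cast (cong (λ d → ⟦ (z ∶⟨ d ⟩ A) ∷ Γ ⟧ᶜ) d≡e) refl

  -- An eliminator at Θ , z , Δ is interpreted as the same eliminator of the
  -- annotated language applied to the variable z :⁰ A ⊢ z : A, the variables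
  -- bound or eliminated being moved past Θ by Swap.
  ⟦_⟧ₑ : ∀ {Γ t A} → Γ ⊢ₑ t ∶ A → ⟦ Γ ⟧ᶜ ⊸ ⟦ A ⟧ᵀ
  ⟦ Unit a xs {Δ} {z} {d} _ t ⟧ₑ =
    exchange [] ((z ∶⟨ d ⟩ 𝟙) ∷ []) Θ Δ
      (regrade z 𝟙 (Θ ++ Δ) (identityʳ d)
        (unit-elim d ((z ∶⟨ 0# ⟩ 𝟙) ∷ []) (Θ ++ Δ) (var-id z 𝟙) ⟦ t ⟧ₑ))
    where Θ = qubitCtx a xs
  ⟦ Tens a xs {Δ} {x} {y} {z} {d} {A = A} {B} _ t ⟧ₑ =
    exchange [] ((z ∶⟨ d ⟩ A ⊠ B) ∷ []) Θ Δ
      (regrade z (A ⊠ B) (Θ ++ Δ) (identityʳ d)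
        (tens-elim d ((z ∶⟨ 0# ⟩ A ⊠ B) ∷ []) (Θ ++ Δ) x y A B (var-id z (A ⊠ B))
          (exchange [] Θ ((x ∶⟨ d ⟩ A) ∷ (y ∶⟨ d ⟩ B) ∷ []) Δ ⟦ t ⟧ₑ)))
    where Θ = qubitCtx a xs
  ⟦ Box a xs {Δ} {x} {z} {d} {e} {A = A} _ t ⟧ₑ =
    exchange [] ((z ∶⟨ d ⟩ □ e A) ∷ []) Θ Δ
      (regrade z (□ e A) (Θ ++ Δ) d+e-e+0≡d
        (box-elim e (d + e) ((z ∶⟨ 0# ⟩ □ e A) ∷ []) (Θ ++ Δ) x A (var-id z (□ e A))
          (exchange [] Θ ((x ∶⟨ d + e ⟩ A) ∷ []) Δ ⟦ t ⟧ₑ)))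
    where
    Θ = qubitCtx a xs
    d+e-e+0≡d : ((d + e) - e) + 0# ≡ d
    d+e-e+0≡d = trans (identityʳ _)
      (trans (assoc d e (- e)) (trans (cong (d +_) (inverseʳ e)) (identityʳ d)))
  ⟦ Circ {a} {b} {xs} c _ t ⟧ₑ =
    ⟦ t ⟧ₙ ∘ cast (sym (⟦qubitCtx⟧ a xs)) (sym (⟦qubitCtx⟧ b (transport c xs))) c

{-# OPTIONS --safe #-}
module Submission where

-- Up to _≈_, casts are invisible, so the eliminators of a normal form denote their
-- bodies, the introduction terms denote identities, and a normal form denotes
-- exactly the circuit c of its Circ rule.  Hence every morphism ⟦ Γ ⟧ᶜ ⊸ ⟦ A ⟧ᵀ
-- is denoted by a normal form: eliminate the non-qubit variables from left to
-- right, then use the morphism itself as c.  Conversely, the types in Γ dictate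
-- which rule comes next, the denotation determines c up to _≈_, and equal circuits
-- permute the variables in the same way, which determines the introduction term.

open import Data.Empty using (⊥-elim)
open import Data.List.Base using (List; []; _∷_; _++_; _∷ʳ_; map; length; take; drop)
open import Data.List.Extrema.Nat using (max; xs≤max)
open import Data.List.Properties using (++-assoc; ++-identityʳ; length-++; length-map; map-++; map-∘; take++drop≡id)
open import Data.List.Relation.Binary.Permutation.Propositional using (_↭_; ↭-refl; ↭-sym; ↭-trans; ↭-reflexive; ↭⇒↭ₛ)
import Data.List.Relation.Binary.Permutation.Propositional.Properties as Perm
import Data.List.Relation.Binary.Permutation.Setoid.Properties as PermS
open import Data.List.Relation.Binary.Pointwise using (Pointwise; []; _∷_)
import Data.List.Relation.Binary.Pointwise as Pointwise
open import Data.List.Relation.Unary.All using (All; []; _∷_)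
import Data.List.Relation.Unary.All as All
import Data.List.Relation.Unary.All.Properties as All
open import Data.List.Relation.Unary.AllPairs using ([]; _∷_)
open import Data.List.Relation.Unary.Unique.Propositional using (Unique)
open import Data.Nat.Base using (ℕ; zero; suc; s≤s)
import Data.Nat.Base as ℕ
open import Data.Nat.Properties using (suc-injective; <-irrefl)
open import Data.Product using (∃; ∃₂; ∃!; Σ-syntax; _×_; _,_; proj₁; proj₂)
open import Relation.Binary.PropositionalEquality
open import Defs

private variable
  X Y : Set

-- Lists: distinct entries, fresh numbers, cutting into blocks.

Unique-resp-↭ : {xs ys : List X} → xs ↭ ys → Unique xs → Unique ys
Unique-resp-↭ p = PermS.Unique-resp-↭ (setoid _) (↭⇒↭ₛ p)

Unique-++⁻ : ∀ (xs : List X) {ys} → Unique (xs ++ ys) → Unique xs × Unique ys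
Unique-++⁻ []       u       = [] , u
Unique-++⁻ (x ∷ xs) (n ∷ u) with u₁ , u₂ ← Unique-++⁻ xs u = All.++⁻ˡ xs n ∷ u₁ , u₂

∃-fresh : (ns : List ℕ) → ∃ λ n → All (n ≢_) ns
∃-fresh ns = suc (max 0 ns) , All.map (λ m≤max n≡m → <-irrefl (sym n≡m) (s≤s m≤max)) (xs≤max 0 ns)

split-length : ∀ m {n} (xs : List X) → length xs ≡ m ℕ.+ n →
               ∃₂ λ ys zs → xs ≡ ys ++ zs × length ys ≡ m × length zs ≡ n
split-length zero    xs       eq = [] , xs , refl , refl , eq
split-length (suc m) (x ∷ xs) eq
  with ys , zs , refl , p , q ← split-length m xs (suc-injective eq) = x ∷ ys , zs , refl , cong suc p , q

take-++ : ∀ n (xs : List X) {ys} → length xs ≡ n → take n (xs ++ ys) ≡ xs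
take-++ _ []       refl = refl
take-++ _ (x ∷ xs) refl = cong (x ∷_) (take-++ _ xs refl)

drop-++ : ∀ n (xs : List X) {ys} → length xs ≡ n → drop n (xs ++ ys) ≡ ys
drop-++ _ []       refl = refl
drop-++ _ (x ∷ xs) refl = drop-++ _ xs refl

module _ {_∼_ : X → Y → Set} where

  Pointwise-take : ∀ n {xs ys} → Pointwise _∼_ xs ys → Pointwise _∼_ (take n xs) (take n ys)
  Pointwise-take zero    _        = []
  Pointwise-take (suc n) []       = []
  Pointwise-take (suc n) (r ∷ rs) = r ∷ Pointwise-take n rs

  Pointwise-drop : ∀ n {xs ys} → Pointwise _∼_ xs ys → Pointwise _∼_ (drop n xs) (drop n ys)
  Pointwise-drop zero    rs       = rs
  Pointwise-drop (suc n) []       = []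
  Pointwise-drop (suc n) (r ∷ rs) = Pointwise-drop n rs

  Pointwise-++⁻ : ∀ xs xs′ {ys ys′} → length xs ≡ length xs′ →
                  Pointwise _∼_ (xs ++ ys) (xs′ ++ ys′) →
                  Pointwise _∼_ xs xs′ × Pointwise _∼_ ys ys′
  Pointwise-++⁻ []       []        _  rs       = [] , rs
  Pointwise-++⁻ (x ∷ xs) (y ∷ xs′) eq (r ∷ rs)
    with ps , qs ← Pointwise-++⁻ xs xs′ (suc-injective eq) rs = r ∷ ps , qs

module Circ (R : OrderedAbelianGroup) (S : Signature R) where

  open OrderedAbelianGroup R
  open Circuits R S

  -- Heterogeneous equality of circuits.

  cast≈ : ∀ {a a′ b b′} (p : a ≡ a′) (q : b ≡ b′) (f : a ⊸ b) → cast p q f ≈ f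
  cast≈ refl refl f = ≈-refl

  id-cong : ∀ {a b} → a ≡ b → id a ≈ id b
  id-cong refl = ≈-refl

  σ-cong : ∀ {a a′ b b′} → a ≡ a′ → b ≡ b′ → σ a b ≈ σ a′ b′
  σ-cong refl refl = ≈-refl

  -- Each axiom relates morphisms whose sources and targets agree by list identities alone. Matching
  -- both equations with `refl` makes the two morphisms parallel.
  ≈⇒≡ : ∀ {a b a′ b′} {f : a ⊸ b} {g : a′ ⊸ b′} → f ≈ g → a ≡ a′ × b ≡ b′
  ≈⇒≡ ≈-refl        = refl , refl
  ≈⇒≡ (≈-sym p)     with refl , refl ← ≈⇒≡ p = refl , refl
  ≈⇒≡ (≈-trans p q) with refl , refl ← ≈⇒≡ p = ≈⇒≡ q
  ≈⇒≡ (∘-cong p q)  = proj₁ (≈⇒≡ q) , proj₂ (≈⇒≡ p)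
  ≈⇒≡ (⊗-cong p q)  with refl , refl ← ≈⇒≡ p | refl , refl ← ≈⇒≡ q = refl , refl
  ≈⇒≡ ∘-identityˡ   = refl , refl
  ≈⇒≡ ∘-identityʳ   = refl , refl
  ≈⇒≡ ∘-assoc       = refl , refl
  ≈⇒≡ ⊗-id          = refl , refl
  ≈⇒≡ interchange   = refl , refl
  ≈⇒≡ ⊗-identityˡ   = refl , refl
  ≈⇒≡ ⊗-identityʳ   = ++-identityʳ _ , ++-identityʳ _
  ≈⇒≡ (⊗-assoc {a} {b} {c} {a′} {b′} {c′}) = ++-assoc a b c , ++-assoc a′ b′ c′
  ≈⇒≡ σ-natural     = refl , refl
  ≈⇒≡ σ-involutive  = refl , refl
  ≈⇒≡ σ-unit        = ++-identityʳ _ , refl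
  ≈⇒≡ (σ-hexagon {a} {b} {c}) = sym (++-assoc a b c) , ++-assoc b c a

  -- The object `x` is left free because the identities met below are casts of `id`; `≈⇒≡` recovers
  -- that it is the source and target of `f`.
  ≈id⇒∘≈ʳ : ∀ {a b c x} {f : b ⊸ c} {g : a ⊸ b} → f ≈ id x → f ∘ g ≈ g
  ≈id⇒∘≈ʳ p with refl , refl ← ≈⇒≡ p = ≈-trans (∘-cong p ≈-refl) ∘-identityˡ

  ≈id⇒∘≈ˡ : ∀ {a b c x} {f : b ⊸ c} {g : a ⊸ b} → g ≈ id x → f ∘ g ≈ f
  ≈id⇒∘≈ˡ p with refl , refl ← ≈⇒≡ p = ≈-trans (∘-cong ≈-refl p) ∘-identityʳ

  -- The composite `s′ ∘ s` is an identity by `interchange` and `σ-involutive`. Both factors are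
  -- known only up to `≈`, since `exchange` wraps its symmetries in casts.
  σ-cancel : ∀ {a b c x y z w v} {f : y ⊸ v} {g : z ⊸ v} {s : x ⊸ y} {s′ : w ⊸ z} →
             f ≈ g ∘ s′ → s ≈ σ a b ⊗ id c → s′ ≈ σ b a ⊗ id c → f ∘ s ≈ g
  σ-cancel p q q′ with refl , refl ← ≈⇒≡ q | refl , refl ← ≈⇒≡ q′ =
    ≈-trans (∘-cong p ≈-refl)
      (≈-trans ∘-assoc (≈id⇒∘≈ˡ
        (≈-trans (∘-cong q′ q)
          (≈-trans (≈-sym interchange) (≈-trans (⊗-cong σ-involutive ∘-identityˡ) ⊗-id)))))

  -- Shifting in time respects equality of circuits.

  Shift-⊗ : ∀ d {a b a′ b′} (f : a ⊸ b) (g : a′ ⊸ b′) → Shift d (f ⊗ g) ≈ Shift d f ⊗ Shift d g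
  Shift-⊗ d f g = cast≈ _ _ _

  Shift-σ : ∀ d a b → Shift d (σ a b) ≈ σ (shift d a) (shift d b)
  Shift-σ d a b = cast≈ _ _ _

  Shift-cast : ∀ d {a a′ b b′} (p : a ≡ a′) (q : b ≡ b′) (f : a ⊸ b) → Shift d (cast p q f) ≈ Shift d f
  Shift-cast d refl refl f = ≈-refl

  -- `Shift` commutes with `⊗` and `σ` only up to casts, so an axiom about them is the same axiom at
  -- the shifted objects, conjugated by `Shift-⊗` and `Shift-σ`.
  Shift-cong : ∀ d {a b a′ b′} {f : a ⊸ b} {g : a′ ⊸ b′} → f ≈ g → Shift d f ≈ Shift d g
  Shift-cong d ≈-refl        = ≈-refl
  Shift-cong d (≈-sym p)     = ≈-sym (Shift-cong d p)
  Shift-cong d (≈-trans p q) = ≈-trans (Shift-cong d p) (Shift-cong d q)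
  Shift-cong d (∘-cong p q)  = ∘-cong (Shift-cong d p) (Shift-cong d q)
  Shift-cong d (⊗-cong {f = f} {f′} {g} {g′} p q) =
    ≈-trans (Shift-⊗ d f g) (≈-trans (⊗-cong (Shift-cong d p) (Shift-cong d q)) (≈-sym (Shift-⊗ d f′ g′)))
  Shift-cong d ∘-identityˡ   = ∘-identityˡ
  Shift-cong d ∘-identityʳ   = ∘-identityʳ
  Shift-cong d ∘-assoc       = ∘-assoc
  Shift-cong d (⊗-id {a} {b}) =
    ≈-trans (Shift-⊗ d (id a) (id b)) (≈-trans ⊗-id (id-cong (sym (shift-++ d a b))))
  Shift-cong d (interchange {f = f} {g} {f′} {g′}) =
    ≈-trans (Shift-⊗ d (f ∘ g) (f′ ∘ g′))
      (≈-trans interchange (∘-cong (≈-sym (Shift-⊗ d f f′)) (≈-sym (Shift-⊗ d g g′))))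
  Shift-cong d (⊗-identityˡ {f = f}) = ≈-trans (Shift-⊗ d (id []) f) ⊗-identityˡ
  Shift-cong d (⊗-identityʳ {f = f}) = ≈-trans (Shift-⊗ d f (id [])) ⊗-identityʳ
  Shift-cong d (⊗-assoc {f = f} {g} {h}) =
    ≈-trans (Shift-⊗ d (f ⊗ g) h) (≈-trans (⊗-cong (Shift-⊗ d f g) ≈-refl)
      (≈-trans ⊗-assoc (≈-trans (⊗-cong ≈-refl (≈-sym (Shift-⊗ d g h))) (≈-sym (Shift-⊗ d f (g ⊗ h))))))
  Shift-cong d (σ-natural {a} {b} {a′} {b′} {f} {g}) =
    ≈-trans (∘-cong (Shift-σ d a′ b′) (Shift-⊗ d f g))
      (≈-trans σ-natural (∘-cong (≈-sym (Shift-⊗ d g f)) (≈-sym (Shift-σ d a b))))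
  Shift-cong d (σ-involutive {a} {b}) =
    ≈-trans (∘-cong (Shift-σ d b a) (Shift-σ d a b)) (≈-trans σ-involutive (id-cong (sym (shift-++ d a b))))
  Shift-cong d (σ-unit {a})  = ≈-trans (Shift-σ d a []) σ-unit
  Shift-cong d (σ-hexagon {a} {b} {c}) =
    ≈-trans (Shift-σ d a (b ++ c)) (≈-trans (σ-cong refl (shift-++ d b c)) (≈-trans σ-hexagon
      (∘-cong
        (≈-trans (⊗-cong ≈-refl (≈-sym (Shift-σ d a c))) (≈-sym (Shift-⊗ d (id b) (σ a c))))
        -- The hexagon contains a cast along associativity: the one over the shifted objects is
        -- stripped here, and the shifted one is put back at the end.
        (≈-trans (cast≈ refl (++-assoc (shift d b) (shift d a) (shift d c)) _)
          (≈-trans (⊗-cong (≈-sym (Shift-σ d a b)) ≈-refl)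
            (≈-trans (≈-sym (Shift-⊗ d (σ a b) (id c)))
              (≈-sym (Shift-cast d refl (++-assoc b a c) (σ a b ⊗ id c)))))))))

  -- Underlying permutations as an invariant of equality of circuits.

  -- The action of transport on plain lists.  It is meaningful on lists of the
  -- length of the source only, but unlike transport it is not indexed by
  -- objects, so that the two sides of f ≈ g can be compared.
  permute : ∀ {a b} → a ⊸ b → List X → List X
  permute (id a)          l = l
  permute (f ∘ g)         l = permute f (permute g l)
  permute (_⊗_ {a} f g)   l = permute f (take (length a) l) ++ permute g (drop (length a) l)
  permute (σ a b)         l = drop (length a) l ++ take (length a) l
  permute (delay _ _ _ _) l = l
  permute (φ G x)         l = l

  -- Holds at every length because `take` and `drop` reassemble any list. It keeps variable names
  -- distinct in the target of a circuit.
  permute-↭ : ∀ {a b} (f : a ⊸ b) (l : List X) → permute f l ↭ l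
  permute-↭ (id a)          l = ↭-refl
  permute-↭ (f ∘ g)         l = ↭-trans (permute-↭ f _) (permute-↭ g l)
  permute-↭ (_⊗_ {a} f g)   l =
    ↭-trans (Perm.++⁺ (permute-↭ f _) (permute-↭ g _)) (↭-reflexive (take++drop≡id (length a) l))
  permute-↭ (σ a b)         l =
    ↭-trans (Perm.++-comm (drop (length a) l) _) (↭-reflexive (take++drop≡id (length a) l))
  permute-↭ (delay _ _ _ _) l = ↭-refl
  permute-↭ (φ G x)         l = ↭-refl

  -- Entries are moved without being inspected, so any relation between two lists survives. This
  -- carries a renaming of variables through a circuit.
  permute-Pointwise : ∀ {_∼_ : X → Y → Set} {a b} (f : a ⊸ b) {l l′} →
                      Pointwise _∼_ l l′ → Pointwise _∼_ (permute f l) (permute f l′)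
  permute-Pointwise (id a)          rs = rs
  permute-Pointwise (f ∘ g)         rs = permute-Pointwise f (permute-Pointwise g rs)
  permute-Pointwise (_⊗_ {a} f g)   rs =
    Pointwise.++⁺ (permute-Pointwise f (Pointwise-take (length a) rs))
                  (permute-Pointwise g (Pointwise-drop (length a) rs))
  permute-Pointwise (σ a b)         rs =
    Pointwise.++⁺ (Pointwise-drop (length a) rs) (Pointwise-take (length a) rs)
  permute-Pointwise (delay _ _ _ _) rs = rs
  permute-Pointwise (φ G x)         rs = rs

  length-target : ∀ {a b} → a ⊸ b → length b ≡ length a
  length-target (id a)          = refl
  length-target (f ∘ g)         = trans (length-target f) (length-target g)
  length-target (_⊗_ {a} {b} f g) =
    trans (length-++ b) (trans (cong₂ ℕ._+_ (length-target f) (length-target g)) (sym (length-++ a)))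
  length-target (σ a b)         = Perm.↭-length (Perm.++-comm b a)
  length-target (delay _ _ _ _) = refl
  length-target (φ G x)         = trans (length-map _ qs) (sym (length-map _ qs))
    where qs = Signature.qubits S G

  length-permute : ∀ {a b} (f : a ⊸ b) {l : List X} → length l ≡ length a → length (permute f l) ≡ length b
  length-permute f {l} eq = trans (Perm.↭-length (permute-↭ f l)) (trans eq (sym (length-target f)))

  permute-⊗ : ∀ {a b a′ b′} (f : a ⊸ b) (g : a′ ⊸ b′) (l : List X) {l′} → length l ≡ length a →
              permute (f ⊗ g) (l ++ l′) ≡ permute f l ++ permute g l′
  permute-⊗ f g l eq = cong₂ (λ m n → permute f m ++ permute g n) (take-++ _ l eq) (drop-++ _ l eq)

  permute-σ : ∀ a b (l l′ : List X) → length l ≡ length a → permute (σ a b) (l ++ l′) ≡ l′ ++ l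
  permute-σ a b l l′ eq = cong₂ _++_ (drop-++ _ l eq) (take-++ _ l eq)

  permute-cast : ∀ {a a′ b b′} (p : a ≡ a′) (q : b ≡ b′) (f : a ⊸ b) (l : List X) →
                 permute (cast p q f) l ≡ permute f l
  permute-cast refl refl f l = refl

  split : ∀ (a b : Obj) (l : List X) → length l ≡ length (a ++ b) →
          ∃₂ λ l₁ l₂ → l ≡ l₁ ++ l₂ × length l₁ ≡ length a × length l₂ ≡ length b
  split a b l eq = split-length (length a) l (trans eq (length-++ a))

  -- Each axiom is checked by cutting the list into blocks that match the objects. The length
  -- hypothesis matters: on a longer list `σ a b` is a rotation, and `σ-involutive` can fail.
  permute-cong : ∀ {a b a′ b′} {f : a ⊸ b} {g : a′ ⊸ b′} → f ≈ g →
                 ∀ (l : List X) → length l ≡ length a → permute f l ≡ permute g l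
  permute-cong ≈-refl        l eq = refl
  permute-cong (≈-sym p)     l eq with refl , refl ← ≈⇒≡ p = sym (permute-cong p l eq)
  permute-cong (≈-trans p q) l eq with refl , refl ← ≈⇒≡ p =
    trans (permute-cong p l eq) (permute-cong q l eq)
  permute-cong (∘-cong {f = f} {g = g} {g′} p q) l eq rewrite sym (permute-cong q l eq) =
    permute-cong p (permute g l) (length-permute g eq)
  permute-cong (⊗-cong {a} {c = c} {f = f} {f′} {g} {g′} p q) l eq
    with l₁ , l₂ , refl , eq₁ , eq₂ ← split a c l eq
    -- Now `length a` is also the length of the source of `f′`, so one cut serves both sides.
    with refl , refl ← ≈⇒≡ p =
    trans (permute-⊗ f g l₁ eq₁)
      (trans (cong₂ _++_ (permute-cong p l₁ eq₁) (permute-cong q l₂ eq₂)) (sym (permute-⊗ f′ g′ l₁ eq₁)))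
  permute-cong ∘-identityˡ   l eq = refl
  permute-cong ∘-identityʳ   l eq = refl
  permute-cong ∘-assoc       l eq = refl
  permute-cong (⊗-id {a})    l eq = take++drop≡id (length a) l
  permute-cong (interchange {a} {a′ = a′} {f = f} {g} {f′} {g′}) l eq
    with l₁ , l₂ , refl , eq₁ , eq₂ ← split a a′ l eq =
    trans (permute-⊗ (f ∘ g) (f′ ∘ g′) l₁ eq₁)
      (trans (sym (permute-⊗ f f′ (permute g l₁) (length-permute g eq₁)))
        (cong (permute (f ⊗ f′)) (sym (permute-⊗ g g′ l₁ eq₁))))
  permute-cong ⊗-identityˡ   l eq = refl
  permute-cong (⊗-identityʳ {a} {f = f}) l eq
    with l₁ , [] , refl , eq₁ , refl ← split a [] l eq =
    trans (permute-⊗ f (id []) l₁ eq₁) (trans (++-identityʳ _) (cong (permute f) (sym (++-identityʳ l₁))))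
  permute-cong (⊗-assoc {a} {b} {c} {f = f} {g} {h}) l eq
    with l₁₂ , l₃ , refl , eq₁₂ , eq₃ ← split (a ++ b) c l eq
    with l₁ , l₂ , refl , eq₁ , eq₂ ← split a b l₁₂ eq₁₂ = begin
    permute ((f ⊗ g) ⊗ h) ((l₁ ++ l₂) ++ l₃)        ≡⟨ permute-⊗ (f ⊗ g) h (l₁ ++ l₂) eq₁₂ ⟩
    permute (f ⊗ g) (l₁ ++ l₂) ++ permute h l₃      ≡⟨ cong (_++ permute h l₃) (permute-⊗ f g l₁ eq₁) ⟩
    (permute f l₁ ++ permute g l₂) ++ permute h l₃  ≡⟨ ++-assoc (permute f l₁) _ _ ⟩
    permute f l₁ ++ permute g l₂ ++ permute h l₃    ≡⟨ cong (permute f l₁ ++_) (permute-⊗ g h l₂ eq₂) ⟨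
    permute f l₁ ++ permute (g ⊗ h) (l₂ ++ l₃)      ≡⟨ permute-⊗ f (g ⊗ h) l₁ eq₁ ⟨
    permute (f ⊗ (g ⊗ h)) (l₁ ++ l₂ ++ l₃)          ≡⟨ cong (permute (f ⊗ (g ⊗ h))) (++-assoc l₁ l₂ l₃) ⟨
    permute (f ⊗ (g ⊗ h)) ((l₁ ++ l₂) ++ l₃)        ∎
    where open ≡-Reasoning
  permute-cong (σ-natural {a} {b} {a′} {b′} {f} {g}) l eq
    with l₁ , l₂ , refl , eq₁ , eq₂ ← split a b l eq = begin
    permute (σ a′ b′) (permute (f ⊗ g) (l₁ ++ l₂))  ≡⟨ cong (permute (σ a′ b′)) (permute-⊗ f g l₁ eq₁) ⟩
    permute (σ a′ b′) (permute f l₁ ++ permute g l₂) ≡⟨ permute-σ a′ b′ (permute f l₁) (permute g l₂) (length-permute f eq₁) ⟩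
    permute g l₂ ++ permute f l₁                    ≡⟨ permute-⊗ g f l₂ eq₂ ⟨
    permute (g ⊗ f) (l₂ ++ l₁)                      ≡⟨ cong (permute (g ⊗ f)) (permute-σ a b l₁ l₂ eq₁) ⟨
    permute (g ⊗ f) (permute (σ a b) (l₁ ++ l₂))    ∎
    where open ≡-Reasoning
  permute-cong (σ-involutive {a} {b}) l eq
    with l₁ , l₂ , refl , eq₁ , eq₂ ← split a b l eq =
    trans (cong (permute (σ b a)) (permute-σ a b l₁ l₂ eq₁)) (permute-σ b a l₂ l₁ eq₂)
  permute-cong (σ-unit {a})  l eq
    with l₁ , [] , refl , eq₁ , refl ← split a [] l eq =
    trans (permute-σ a [] l₁ [] eq₁) (sym (++-identityʳ l₁))
  permute-cong (σ-hexagon {a} {b} {c}) l eq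
    with l₁ , l₂₃ , refl , eq₁ , eq₂₃ ← split a (b ++ c) l eq
    with l₂ , l₃ , refl , eq₂ , eq₃ ← split b c l₂₃ eq₂₃ = begin
    permute (σ a (b ++ c)) (l₁ ++ l₂ ++ l₃)         ≡⟨ permute-σ a (b ++ c) l₁ (l₂ ++ l₃) eq₁ ⟩
    (l₂ ++ l₃) ++ l₁                                ≡⟨ ++-assoc l₂ l₃ l₁ ⟩
    l₂ ++ l₃ ++ l₁                                  ≡⟨ cong (l₂ ++_) (permute-σ a c l₁ l₃ eq₁) ⟨
    l₂ ++ permute (σ a c) (l₁ ++ l₃)                ≡⟨ permute-⊗ (id b) (σ a c) l₂ eq₂ ⟨
    permute (id b ⊗ σ a c) (l₂ ++ l₁ ++ l₃)         ≡⟨ cong (permute (id b ⊗ σ a c)) lemma ⟨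
    permute (id b ⊗ σ a c) (permute (cast refl (++-assoc b a c) (σ a b ⊗ id c)) (l₁ ++ l₂ ++ l₃)) ∎
    where
    open ≡-Reasoning
    lemma : permute (cast refl (++-assoc b a c) (σ a b ⊗ id c)) (l₁ ++ l₂ ++ l₃) ≡ l₂ ++ l₁ ++ l₃
    lemma = begin
      permute (cast refl (++-assoc b a c) (σ a b ⊗ id c)) (l₁ ++ l₂ ++ l₃)
        ≡⟨ permute-cast refl (++-assoc b a c) (σ a b ⊗ id c) _ ⟩
      permute (σ a b ⊗ id c) (l₁ ++ l₂ ++ l₃)
        -- `σ a b ⊗ id c` cuts after a block as long as `a ++ b`, which reassociation exposes.
        ≡⟨ cong (permute (σ a b ⊗ id c)) (++-assoc l₁ l₂ l₃) ⟨
      permute (σ a b ⊗ id c) ((l₁ ++ l₂) ++ l₃)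
        ≡⟨ permute-⊗ (σ a b) (id c) (l₁ ++ l₂) (trans (length-++ l₁) (trans (cong₂ ℕ._+_ eq₁ eq₂) (sym (length-++ a)))) ⟩
      permute (σ a b) (l₁ ++ l₂) ++ l₃
        ≡⟨ cong (_++ l₃) (permute-σ a b l₁ l₂ eq₁) ⟩
      (l₂ ++ l₁) ++ l₃
        ≡⟨ ++-assoc l₂ l₁ l₃ ⟩
      l₂ ++ l₁ ++ l₃ ∎

  -- Labellings as plain lists.

  labels : ∀ {a} → Labelling X a → List X
  labels = All.reduce λ x → x

  length-labels : ∀ {a} (xs : Labelling X a) → length (labels xs) ≡ length a
  length-labels []       = refl
  length-labels (x ∷ xs) = cong suc (length-labels xs)

  labels-++⁺ : ∀ {a b} (xs : Labelling X a) (ys : Labelling X b) → labels (All.++⁺ xs ys) ≡ labels xs ++ labels ys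
  labels-++⁺ []       ys = refl
  labels-++⁺ (x ∷ xs) ys = cong (x ∷_) (labels-++⁺ xs ys)

  labels-++⁻ : ∀ a {b} (xs : Labelling X (a ++ b)) →
               labels (proj₁ (All.++⁻ a xs)) ≡ take (length a) (labels xs) ×
               labels (proj₂ (All.++⁻ a xs)) ≡ drop (length a) (labels xs)
  labels-++⁻ []      xs       = refl , refl
  labels-++⁻ (_ ∷ a) (x ∷ xs) with p , q ← labels-++⁻ a xs = cong (x ∷_) p , q

  labels-at : ∀ {x y} qs (xs : Labelling X (at x qs)) → labels {a = at y qs} (All.map⁺ (All.map⁻ xs)) ≡ labels xs
  labels-at []       []       = refl
  labels-at (q ∷ qs) (x ∷ xs) = cong (x ∷_) (labels-at qs xs)

  -- Erasing the object index turns `transport` into `permute`, so that `permute-cong` applies to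
  -- variables carried along equal circuits.
  labels-transport : ∀ {a b} (f : a ⊸ b) (xs : Labelling X a) → labels (transport f xs) ≡ permute f (labels xs)
  labels-transport (id a)  xs = refl
  labels-transport (f ∘ g) xs =
    trans (labels-transport f (transport g xs)) (cong (permute f) (labels-transport g xs))
  labels-transport (_⊗_ {a} f g) xs with p , q ← labels-++⁻ a xs =
    trans (labels-++⁺ (transport f (proj₁ (All.++⁻ a xs))) _)
      (cong₂ _++_ (trans (labels-transport f _) (cong (permute f) p))
                  (trans (labels-transport g _) (cong (permute g) q)))
  labels-transport (σ a b) xs with p , q ← labels-++⁻ a xs =
    trans (labels-++⁺ (proj₂ (All.++⁻ a xs)) _) (cong₂ _++_ q p)
  labels-transport (delay _ _ _ _) (x ∷ []) = refl
  labels-transport (φ G x) xs = labels-at {x = x} (Signature.qubits S G) xs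

module Normalisation (R : OrderedAbelianGroup) (S : Signature R) where

  open OrderedAbelianGroup R
  open Language R S
  open Decl
  open Circ R S

  -- Distinctness of the variables of a context.

  names : Ctx → List Name
  names = map name

  Fresh : Name → Ctx → Set
  Fresh x Γ = All (x ≢_) (names Γ)

  names-+ᶜ : ∀ d Γ → names (d +ᶜ Γ) ≡ names Γ
  names-+ᶜ d Γ = sym (map-∘ Γ)

  Distinct-+ᶜ : ∀ d Γ → Distinct Γ → Distinct (d +ᶜ Γ)
  Distinct-+ᶜ d Γ = subst Unique (sym (names-+ᶜ d Γ))

  Distinct-resp-↭ : ∀ {Γ Δ} → Γ ↭ Δ → Distinct Γ → Distinct Δ
  Distinct-resp-↭ p = Unique-resp-↭ (Perm.map⁺ name p)

  Distinct-insert : ∀ Γ {Δ δ} → Fresh (name δ) (Γ ++ Δ) → Distinct (Γ ++ Δ) → Distinct (Γ ++ δ ∷ Δ)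
  Distinct-insert Γ {Δ} {δ} fresh distinct =
    Distinct-resp-↭ (↭-sym (Perm.shift δ Γ Δ)) (fresh ∷ distinct)

  Distinct-delete : ∀ Γ {Δ δ} → Distinct (Γ ++ δ ∷ Δ) →
                    Fresh (name δ) Γ × Fresh (name δ) Δ × Distinct (Γ ++ Δ)
  Distinct-delete Γ {Δ} {δ} distinct
    with fresh ∷ distinct′ ← Distinct-resp-↭ (Perm.shift δ Γ Δ) distinct
    with fresh₁ , fresh₂ ← All.++⁻ (names Γ) (subst (All (name δ ≢_)) (map-++ name Γ Δ) fresh) =
    fresh₁ , fresh₂ , distinct′

  -- Rules that join contexts carry a `Distinct` premise; `Swap` permutes declarations and the
  -- shifting rules keep the names. Normalisation starts from this.
  ⊢⇒Distinct : ∀ {Γ t A} → Γ ⊢ t ∶ A → Distinct Γ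
  ⊢⇒Distinct (Swap {Γ} {Δ} {x} {y} {d} {e} {A} {B} D) =
    Distinct-resp-↭ (Perm.++⁺ˡ Γ (Perm.shifts ((x ∶⟨ d ⟩ A) ∷ []) ((y ∶⟨ e ⟩ B) ∷ []) {Δ})) (⊢⇒Distinct D)
  ⊢⇒Distinct Var                         = [] ∷ []
  ⊢⇒Distinct Unit-I                      = []
  ⊢⇒Distinct (Unit-E _ distinct _ _)     = distinct
  ⊢⇒Distinct (Gate-I {Γ} _ distinct _)   = Distinct-+ᶜ _ Γ distinct
  ⊢⇒Distinct (Tens-I distinct _ _)       = distinct
  ⊢⇒Distinct (Tens-E distinct _ _)       = distinct
  ⊢⇒Distinct (Box-I {Γ} d D)             = Distinct-+ᶜ d Γ (⊢⇒Distinct D)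
  ⊢⇒Distinct (Box-E distinct _ _)        = distinct
  ⊢⇒Distinct (Delay {Γ} d _ D)           = Distinct-+ᶜ _ Γ (⊢⇒Distinct D)
  ⊢⇒Distinct (Let distinct _ _)          = distinct

  -- Applied to the premise of an eliminator, this makes the bound variables fresh for the rest of
  -- the context.
  ⊢ₑ⇒Distinct : ∀ {Γ t A} → Γ ⊢ₑ t ∶ A → Distinct Γ
  ⊢ₑ⇒Distinct (Unit _ _ distinct _) = distinct
  ⊢ₑ⇒Distinct (Tens _ _ distinct _) = distinct
  ⊢ₑ⇒Distinct (Box _ _ distinct _)  = distinct
  ⊢ₑ⇒Distinct (Circ _ distinct _)   = distinct

  -- Contexts of qubits.

  names-qubitCtx : ∀ a xs → names (qubitCtx a xs) ≡ labels xs
  names-qubitCtx []      []       = refl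
  names-qubitCtx (_ ∷ a) (x ∷ xs) = cong (x ∷_) (names-qubitCtx a xs)

  qubitCtx-++ : ∀ a b xs → qubitCtx (a ++ b) xs ≡
                qubitCtx a (proj₁ (All.++⁻ a xs)) ++ qubitCtx b (proj₂ (All.++⁻ a xs))
  qubitCtx-++ []      b xs       = refl
  qubitCtx-++ (_ ∷ a) b (x ∷ xs) = cong (_ ∷_) (qubitCtx-++ a b xs)

  qubitCtx-shift : ∀ d a xs → qubitCtx (shift d a) xs ≡ d +ᶜ qubitCtx a (All.map⁻ xs)
  qubitCtx-shift d []      []       = refl
  qubitCtx-shift d (_ ∷ a) (x ∷ xs) = cong (_ ∷_) (qubitCtx-shift d a xs)

  -- A qubit standing right after the prefix becomes the last entry of a longer prefix.
  qubitCtx-∷ʳ : ∀ a xs z d q Δ →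
                qubitCtx (a ∷ʳ (d , q)) (All.∷ʳ⁺ xs z) ++ Δ ≡ qubitCtx a xs ++ (z ∶⟨ d ⟩ qubit q) ∷ Δ
  qubitCtx-∷ʳ []      []       z d q Δ = refl
  qubitCtx-∷ʳ (_ ∷ a) (x ∷ xs) z d q Δ = cong (_ ∷_) (qubitCtx-∷ʳ a xs z d q Δ)

  -- Denotations of normal forms.

  ⟦⟧ₙ≈id : ∀ {Γ t A} (N : Γ ⊢ₙ t ∶ A) → ⟦ N ⟧ₙ ≈ id ⟦ A ⟧ᵀ
  ⟦⟧ₙ≈id Unit                = ≈-refl
  ⟦⟧ₙ≈id Var                 = cast≈ _ _ _
  ⟦⟧ₙ≈id (Tens {Γ} {Δ} _ M N) =
    ≈-trans (cast≈ (sym (⟦++⟧ Γ Δ)) refl _) (≈-trans (⊗-cong (⟦⟧ₙ≈id M) (⟦⟧ₙ≈id N)) ⊗-id)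
  ⟦⟧ₙ≈id (Box {Γ} d N)       =
    ≈-trans (cast≈ (sym (⟦+ᶜ⟧ d Γ)) refl _) (Shift-cong d (⟦⟧ₙ≈id N))

  Shift-var-id : ∀ d z A → Shift d (var-id z A) ≈ id (shift d ⟦ A ⟧ᵀ)
  Shift-var-id d z A = Shift-cast d (sym (trans (++-identityʳ _) (shift-0 ⟦ A ⟧ᵀ))) refl (id ⟦ A ⟧ᵀ)

  -- The morphism with which `exchange []` precomposes.
  braid : ∀ Φ Ψ Δ → ⟦ Ψ ++ Φ ++ Δ ⟧ᶜ ⊸ ⟦ Φ ++ Ψ ++ Δ ⟧ᶜ
  braid Φ Ψ Δ = cast (⟦exchange⟧ [] Ψ Φ Δ) (⟦exchange⟧ [] Φ Ψ Δ) (id [] ⊗ (σ ⟦ Ψ ⟧ᶜ ⟦ Φ ⟧ᶜ ⊗ id ⟦ Δ ⟧ᶜ))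

  braid≈ : ∀ Φ Ψ Δ → braid Φ Ψ Δ ≈ σ ⟦ Ψ ⟧ᶜ ⟦ Φ ⟧ᶜ ⊗ id ⟦ Δ ⟧ᶜ
  braid≈ Φ Ψ Δ = ≈-trans (cast≈ (⟦exchange⟧ [] Ψ Φ Δ) (⟦exchange⟧ [] Φ Ψ Δ) _) ⊗-identityˡ

  -- An eliminator moves its variable `Φ` in front of `Θ`, opens it into `Ψ` and moves that back.
  -- Opening does not change the object, so the two symmetries are mutually inverse.
  exchange-cancel : ∀ Φ Ψ Θ Δ {b} → ⟦ Φ ⟧ᶜ ≡ ⟦ Ψ ⟧ᶜ →
                    {f : ⟦ Φ ++ Θ ++ Δ ⟧ᶜ ⊸ b} {g : ⟦ Θ ++ Ψ ++ Δ ⟧ᶜ ⊸ b} →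
                    f ≈ exchange [] Θ Ψ Δ g → exchange [] Φ Θ Δ f ≈ g
  exchange-cancel Φ Ψ Θ Δ Φ≡Ψ p =
    σ-cancel p (≈-trans (braid≈ Φ Θ Δ) (⊗-cong (σ-cong refl Φ≡Ψ) ≈-refl)) (braid≈ Θ Ψ Δ)

  ⟦⊠⟧ : ∀ x y z d A B → ⟦ (z ∶⟨ d ⟩ A ⊠ B) ∷ [] ⟧ᶜ ≡ ⟦ (x ∶⟨ d ⟩ A) ∷ (y ∶⟨ d ⟩ B) ∷ [] ⟧ᶜ
  ⟦⊠⟧ x y z d A B =
    trans (cong (_++ []) (shift-++ d ⟦ A ⟧ᵀ ⟦ B ⟧ᵀ)) (++-assoc (shift d ⟦ A ⟧ᵀ) _ _)

  ⟦□⟧ : ∀ x z d e A → ⟦ (z ∶⟨ d ⟩ □ e A) ∷ [] ⟧ᶜ ≡ ⟦ (x ∶⟨ d + e ⟩ A) ∷ [] ⟧ᶜ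
  ⟦□⟧ x z d e A = cong (_++ []) (shift-shift d e ⟦ A ⟧ᵀ)

  ⟦Unit⟧≈ : ∀ a xs {Δ x d t A} distinct (E : qubitCtx a xs ++ Δ ⊢ₑ t ∶ A) →
            ⟦ Unit a xs {Δ} {x} {d} distinct E ⟧ₑ ≈ ⟦ E ⟧ₑ
  ⟦Unit⟧≈ a xs {Δ} {x} {d} _ E =
    ≈-trans
      -- The unit type denotes the empty object, so the symmetry past it is trivial.
      (≈id⇒∘≈ˡ (≈-trans (braid≈ ((x ∶⟨ d ⟩ 𝟙) ∷ []) Θ Δ) (≈-trans (⊗-cong σ-unit ≈-refl) ⊗-id)))
      (≈-trans (cast≈ (cong (λ e → ⟦ (x ∶⟨ e ⟩ 𝟙) ∷ Θ ++ Δ ⟧ᶜ) (identityʳ d)) refl _)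
        (≈-trans (cast≈ (sym (⟦+ᶜ++⟧ d ((x ∶⟨ 0# ⟩ 𝟙) ∷ []) (Θ ++ Δ))) refl _)
          (≈-trans (⊗-cong (Shift-var-id d x 𝟙) ≈-refl) ⊗-identityˡ)))
    where Θ = qubitCtx a xs

  ⟦Tens⟧≈ : ∀ a xs {Δ x y z d t A B C} distinct
            (E : qubitCtx a xs ++ (x ∶⟨ d ⟩ A) ∷ (y ∶⟨ d ⟩ B) ∷ Δ ⊢ₑ t ∶ C) →
            ⟦ Tens a xs {z = z} distinct E ⟧ₑ ≈ ⟦ E ⟧ₑ
  ⟦Tens⟧≈ a xs {Δ} {x} {y} {z} {d} {A = A} {B} _ E =
    exchange-cancel ((z ∶⟨ d ⟩ A ⊠ B) ∷ []) ((x ∶⟨ d ⟩ A) ∷ (y ∶⟨ d ⟩ B) ∷ []) Θ Δ (⟦⊠⟧ x y z d A B)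
      (≈-trans (cast≈ (cong (λ e → ⟦ (z ∶⟨ e ⟩ A ⊠ B) ∷ Θ ++ Δ ⟧ᶜ) (identityʳ d)) refl _)
        -- The eliminated term is a variable, so opening it precomposes with an identity and only
        -- the inner `exchange` is left.
        (≈id⇒∘≈ˡ (≈-trans (cast≈ (sym (⟦+ᶜ++⟧ d ((z ∶⟨ 0# ⟩ A ⊠ B) ∷ []) (Θ ++ Δ))) _ _)
          (≈-trans (⊗-cong (Shift-var-id d z (A ⊠ B)) ≈-refl) ⊗-id))))
    where Θ = qubitCtx a xs

  ⟦Box⟧≈ : ∀ a xs {Δ x z d e t A B} distinct
           (E : qubitCtx a xs ++ (x ∶⟨ d + e ⟩ A) ∷ Δ ⊢ₑ t ∶ B) →
           ⟦ Box a xs {z = z} {d} {e} distinct E ⟧ₑ ≈ ⟦ E ⟧ₑ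
  ⟦Box⟧≈ a xs {Δ} {x} {z} {d} {e} {A = A} _ E =
    exchange-cancel ((z ∶⟨ d ⟩ □ e A) ∷ []) ((x ∶⟨ d + e ⟩ A) ∷ []) Θ Δ (⟦□⟧ x z d e A)
      (≈-trans (cast≈ (cong (λ e′ → ⟦ (z ∶⟨ e′ ⟩ □ e A) ∷ Θ ++ Δ ⟧ᶜ) _) refl _)
        (≈id⇒∘≈ˡ (≈-trans (cast≈ (sym (⟦+ᶜ++⟧ ((d + e) - e) ((z ∶⟨ 0# ⟩ □ e A) ∷ []) (Θ ++ Δ))) _ _)
          (≈-trans (⊗-cong (Shift-var-id ((d + e) - e) z (□ e A)) ≈-refl) ⊗-id))))
    where Θ = qubitCtx a xs

  ⟦Circ⟧≈ : ∀ {a b xs t B} (c : a ⊸ b) distinct (N : qubitCtx b (transport c xs) ⊢ₙ t ∶ B) →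
            ⟦ Circ {xs = xs} c distinct N ⟧ₑ ≈ c
  ⟦Circ⟧≈ {a} {b} {xs} c _ N =
    ≈-trans (≈id⇒∘≈ʳ (⟦⟧ₙ≈id N)) (cast≈ (sym (⟦qubitCtx⟧ a xs)) (sym (⟦qubitCtx⟧ b (transport c xs))) c)

  -- Existence of normal forms.

  -- Recursion on `A`, which dictates the term. The context lies over `⟦ A ⟧ᵀ` itself, so the term
  -- can follow any circuit into that object.
  intro : ∀ A xs → Distinct (qubitCtx ⟦ A ⟧ᵀ xs) → ∃ λ t → qubitCtx ⟦ A ⟧ᵀ xs ⊢ₙ t ∶ A
  intro 𝟙         []       _ = ⋆ , Unit
  intro (qubit q) (x ∷ []) _ = var x , Var
  intro (A ⊠ B)   xs       distinct
    rewrite qubitCtx-++ ⟦ A ⟧ᵀ ⟦ B ⟧ᵀ xs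
    with ys , zs ← All.++⁻ ⟦ A ⟧ᵀ xs
    with distinct₁ , distinct₂ ← Unique-++⁻ (names (qubitCtx ⟦ A ⟧ᵀ ys))
                                   (subst Unique (map-++ name (qubitCtx ⟦ A ⟧ᵀ ys) _) distinct)
    with s , M ← intro A ys distinct₁
    with t , N ← intro B zs distinct₂ = pair s t , Tens distinct M N
  intro (□ d A)   xs       distinct
    rewrite qubitCtx-shift d ⟦ A ⟧ᵀ xs
    with t , N ← intro A (All.map⁻ xs) (subst Unique (names-+ᶜ d _) distinct) = box d t , Box d N

  -- Neither the source nor the target of f is required to be the expected object
  -- on the nose, so that no casts accumulate along the eliminators.
  Normalisable : Ctx → Type → Set
  Normalisable Γ A = Distinct Γ → ∀ {a b} (f : a ⊸ b) → a ≡ ⟦ Γ ⟧ᶜ → b ≡ ⟦ A ⟧ᵀ →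
                     ∃ λ u → Σ[ E ∈ Γ ⊢ₑ u ∶ A ] f ≈ ⟦ E ⟧ₑ

  normalise-qubits : ∀ {A} a xs → Normalisable (qubitCtx a xs) A
  normalise-qubits {A} a xs distinct f refl refl =
    t after c , Circ c distinct N , ≈-trans (≈-sym c≈f) (≈-sym (⟦Circ⟧≈ c distinct N))
    where
    c : a ⊸ ⟦ A ⟧ᵀ
    -- The circuit is `f` itself; the cast is there because a qubit of grade `d` is interpreted at
    -- time `d + 0#`.
    c = cast (⟦qubitCtx⟧ a xs) refl f
    c≈f : c ≈ f
    c≈f = cast≈ (⟦qubitCtx⟧ a xs) refl f
    distinct′ : Distinct (qubitCtx ⟦ A ⟧ᵀ (transport c xs))
    -- The names in the target permute those in the source.
    distinct′ = subst Unique (sym (trans (names-qubitCtx _ (transport c xs)) (labels-transport c xs)))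
      (Unique-resp-↭ (↭-sym (permute-↭ c _)) (subst Unique (names-qubitCtx a xs) distinct))
    t = proj₁ (intro A (transport c xs) distinct′)
    N = proj₂ (intro A (transport c xs) distinct′)

  -- Lets the same morphism `f` serve for the context before and after a variable is opened.
  ⟦replace⟧ : ∀ Θ Φ Ψ Δ → ⟦ Φ ⟧ᶜ ≡ ⟦ Ψ ⟧ᶜ → ⟦ Θ ++ Φ ++ Δ ⟧ᶜ ≡ ⟦ Θ ++ Ψ ++ Δ ⟧ᶜ
  ⟦replace⟧ Θ Φ Ψ Δ Φ≡Ψ
    rewrite ⟦++⟧ Θ (Φ ++ Δ) | ⟦++⟧ Θ (Ψ ++ Δ) | ⟦++⟧ Φ Δ | ⟦++⟧ Ψ Δ | Φ≡Ψ = refl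

  -- Recursion on the type of the declaration after the qubit prefix. The hypothesis on `Δ` allows
  -- every prefix, since the qubits uncovered in `B` end up there.
  eliminate : ∀ B {z d Δ A} → (∀ a xs → Normalisable (qubitCtx a xs ++ Δ) A) →
              ∀ a xs → Normalisable (qubitCtx a xs ++ (z ∶⟨ d ⟩ B) ∷ Δ) A
  eliminate 𝟙 {z} {d} {Δ} ih a xs distinct f src tgt
    with u , E , eq ← ih a xs (proj₂ (proj₂ (Distinct-delete (qubitCtx a xs) distinct))) f
                        (trans src (⟦replace⟧ (qubitCtx a xs) ((z ∶⟨ d ⟩ 𝟙) ∷ []) [] Δ refl)) tgt =
    let⋆ (var z) u , Unit a xs distinct E , ≈-trans eq (≈-sym (⟦Unit⟧≈ a xs distinct E))
  eliminate (qubit q) {z} {d} {Δ} {A} ih a xs =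
    subst (λ Γ → Normalisable Γ A) (qubitCtx-∷ʳ a xs z d q Δ) (ih (a ∷ʳ (d , q)) (All.∷ʳ⁺ xs z))
  eliminate (B ⊠ C) {z} {d} {Δ} ih a xs distinct f src tgt
    with y , y-fresh ← ∃-fresh (names (qubitCtx a xs ++ Δ))
    -- Here `x` has to avoid `y` as well.
    with x , x-fresh ← ∃-fresh (names (qubitCtx a xs ++ (y ∶⟨ d ⟩ C) ∷ Δ))
    -- Eliminating `C` is the hypothesis for what follows `B`, so the components are opened from
    -- left to right.
    with u , E , eq ← eliminate B {x} {d} (eliminate C {y} {d} ih) a xs
                        (Distinct-insert (qubitCtx a xs) x-fresh (Distinct-insert (qubitCtx a xs) y-fresh
                          (proj₂ (proj₂ (Distinct-delete (qubitCtx a xs) distinct))))) f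
                        (trans src (⟦replace⟧ (qubitCtx a xs) ((z ∶⟨ d ⟩ B ⊠ C) ∷ [])
                          ((x ∶⟨ d ⟩ B) ∷ (y ∶⟨ d ⟩ C) ∷ []) Δ (⟦⊠⟧ x y z d B C))) tgt =
    letpair x y (var z) u , Tens a xs distinct E , ≈-trans eq (≈-sym (⟦Tens⟧≈ a xs distinct E))
  eliminate (□ e B) {z} {d} {Δ} ih a xs distinct f src tgt
    with x , x-fresh ← ∃-fresh (names (qubitCtx a xs ++ Δ))
    with u , E , eq ← eliminate B {x} {d + e} ih a xs
                        (Distinct-insert (qubitCtx a xs) x-fresh (proj₂ (proj₂ (Distinct-delete (qubitCtx a xs) distinct)))) f
                        (trans src (⟦replace⟧ (qubitCtx a xs) ((z ∶⟨ d ⟩ □ e B) ∷ [])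
                          ((x ∶⟨ d + e ⟩ B) ∷ []) Δ (⟦□⟧ x z d e B))) tgt =
    letbox e x (var z) u , Box a xs distinct E , ≈-trans eq (≈-sym (⟦Box⟧≈ a xs distinct E))

  normalise : ∀ {A} Γ a xs → Normalisable (qubitCtx a xs ++ Γ) A
  normalise {A} [] a xs =
    subst (λ Γ → Normalisable Γ A) (sym (++-identityʳ (qubitCtx a xs))) (normalise-qubits a xs)
  normalise ((z ∶⟨ d ⟩ B) ∷ Γ) = eliminate B (normalise Γ)

  -- Contexts that agree up to a renaming.

  infix 4 _⊢_~ᵈ_ _⊢_~ᶜ_

  -- Two normal forms may bind different names, so below a binder their contexts agree only up to
  -- `ρ`; grades and types still coincide.
  data _⊢_~ᵈ_ (ρ : Renaming) : Decl → Decl → Set where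
    decl : ∀ {x x′ d A} → ρ ⊢ x ~ x′ → ρ ⊢ x ∶⟨ d ⟩ A ~ᵈ x′ ∶⟨ d ⟩ A

  _⊢_~ᶜ_ : Renaming → Ctx → Ctx → Set
  ρ ⊢ Γ ~ᶜ Γ′ = Pointwise (ρ ⊢_~ᵈ_) Γ Γ′

  ~ᶜ-refl : ∀ Γ → [] ⊢ Γ ~ᶜ Γ
  ~ᶜ-refl []      = []
  ~ᶜ-refl (_ ∷ Γ) = decl free ∷ ~ᶜ-refl Γ

  ~ᶜ-names : ∀ {ρ Γ Γ′} → ρ ⊢ Γ ~ᶜ Γ′ → Pointwise (ρ ⊢_~_) (names Γ) (names Γ′)
  ~ᶜ-names []            = []
  ~ᶜ-names (decl r ∷ rs) = r ∷ ~ᶜ-names rs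

  ~ᶜ-weaken : ∀ {ρ Γ Γ′ x x′} → Fresh x Γ → Fresh x′ Γ′ → ρ ⊢ Γ ~ᶜ Γ′ → (x , x′) ∷ ρ ⊢ Γ ~ᶜ Γ′
  ~ᶜ-weaken []       []         []            = []
  ~ᶜ-weaken (n ∷ ns) (n′ ∷ ns′) (decl r ∷ rs) =
    decl (there (≢-sym n) (≢-sym n′) r) ∷ ~ᶜ-weaken ns ns′ rs

  ~ᶜ-bind : ∀ {ρ} Γ Γ′ {Δ Δ′ x x′ d A} →
            Distinct (Γ ++ (x ∶⟨ d ⟩ A) ∷ Δ) → Distinct (Γ′ ++ (x′ ∶⟨ d ⟩ A) ∷ Δ′) →
            ρ ⊢ Γ ~ᶜ Γ′ → ρ ⊢ Δ ~ᶜ Δ′ →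
            (x , x′) ∷ ρ ⊢ Γ ++ (x ∶⟨ d ⟩ A) ∷ Δ ~ᶜ Γ′ ++ (x′ ∶⟨ d ⟩ A) ∷ Δ′
  ~ᶜ-bind Γ Γ′ distinct distinct′ rs ss
    with n₁ , n₂ , _ ← Distinct-delete Γ distinct | n₁′ , n₂′ , _ ← Distinct-delete Γ′ distinct′ =
    Pointwise.++⁺ (~ᶜ-weaken n₁ n₁′ rs) (decl here ∷ ~ᶜ-weaken n₂ n₂′ ss)

  ~ᶜ-bind₂ : ∀ {ρ} Γ Γ′ {Δ Δ′ x x′ y y′ d e A B} →
             Distinct (Γ ++ (x ∶⟨ d ⟩ A) ∷ (y ∶⟨ e ⟩ B) ∷ Δ) →
             Distinct (Γ′ ++ (x′ ∶⟨ d ⟩ A) ∷ (y′ ∶⟨ e ⟩ B) ∷ Δ′) →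
             ρ ⊢ Γ ~ᶜ Γ′ → ρ ⊢ Δ ~ᶜ Δ′ →
             (y , y′) ∷ (x , x′) ∷ ρ ⊢ Γ ++ (x ∶⟨ d ⟩ A) ∷ (y ∶⟨ e ⟩ B) ∷ Δ
                                     ~ᶜ Γ′ ++ (x′ ∶⟨ d ⟩ A) ∷ (y′ ∶⟨ e ⟩ B) ∷ Δ′
  ~ᶜ-bind₂ Γ Γ′ distinct distinct′ rs ss
    with n₁ , n ∷ n₂ , d₁ ← Distinct-delete Γ distinct | n₁′ , n′ ∷ n₂′ , d₁′ ← Distinct-delete Γ′ distinct′
    with m₁ , m₂ , _ ← Distinct-delete Γ d₁ | m₁′ , m₂′ , _ ← Distinct-delete Γ′ d₁′ =
    Pointwise.++⁺ (~ᶜ-weaken m₁ m₁′ (~ᶜ-weaken n₁ n₁′ rs))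
      -- The second variable is the inner binder, so the first is reached past it, which needs the
      -- two to differ on each side.
      (decl (there n n′ here) ∷ decl here ∷ ~ᶜ-weaken m₂ m₂′ (~ᶜ-weaken n₂ n₂′ ss))

  NonQubit : Type → Set
  NonQubit A = ∀ {q} → A ≢ qubit q

  -- Related declarations have equal types, so the first non-qubit stands at the same position in
  -- both contexts.
  ~ᶜ-split : ∀ {ρ} a xs a′ xs′ {Δ Δ′ z z′ d d′ A A′} → NonQubit A → NonQubit A′ →
             ρ ⊢ qubitCtx a xs ++ (z ∶⟨ d ⟩ A) ∷ Δ ~ᶜ qubitCtx a′ xs′ ++ (z′ ∶⟨ d′ ⟩ A′) ∷ Δ′ →
             ρ ⊢ qubitCtx a xs ~ᶜ qubitCtx a′ xs′ × (ρ ⊢ z ∶⟨ d ⟩ A ~ᵈ z′ ∶⟨ d′ ⟩ A′) × ρ ⊢ Δ ~ᶜ Δ′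
  ~ᶜ-split []      []       []       []         _ _  (r ∷ rs)      = [] , r , rs
  ~ᶜ-split []      []       (_ ∷ a′) (_ ∷ xs′)  n _  (decl _ ∷ _)  = ⊥-elim (n refl)
  ~ᶜ-split (_ ∷ a) (_ ∷ xs) []       []         _ n′ (decl _ ∷ _)  = ⊥-elim (n′ refl)
  ~ᶜ-split (_ ∷ a) (_ ∷ xs) (_ ∷ a′) (_ ∷ xs′)  n n′ (r ∷ rs)
    with ps , q , qs ← ~ᶜ-split a xs a′ xs′ n n′ rs = r ∷ ps , q , qs

  -- The hypotheses are contradictory; this excludes `Circ` against an eliminator.
  ~ᶜ-qubits : ∀ {ρ} a xs a′ xs′ {Δ z d A} {X : Set} → NonQubit A →
              ρ ⊢ qubitCtx a xs ~ᶜ qubitCtx a′ xs′ ++ (z ∶⟨ d ⟩ A) ∷ Δ → X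
  ~ᶜ-qubits (_ ∷ a) (_ ∷ xs) []       []        n (decl _ ∷ _) = ⊥-elim (n refl)
  ~ᶜ-qubits (_ ∷ a) (_ ∷ xs) (_ ∷ a′) (_ ∷ xs′) n (_ ∷ rs)     = ~ᶜ-qubits a xs a′ xs′ n rs

  ~ᶜ-qubits′ : ∀ {ρ} a xs a′ xs′ {Δ z d A} {X : Set} → NonQubit A →
               ρ ⊢ qubitCtx a′ xs′ ++ (z ∶⟨ d ⟩ A) ∷ Δ ~ᶜ qubitCtx a xs → X
  ~ᶜ-qubits′ (_ ∷ a) (_ ∷ xs) []       []        n (decl _ ∷ _) = ⊥-elim (n refl)
  ~ᶜ-qubits′ (_ ∷ a) (_ ∷ xs) (_ ∷ a′) (_ ∷ xs′) n (_ ∷ rs)     = ~ᶜ-qubits′ a xs a′ xs′ n rs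

  -- Uniqueness of normal forms.

  ⊢ₙ-length : ∀ {Γ t A} → Γ ⊢ₙ t ∶ A → length (names Γ) ≡ length ⟦ A ⟧ᵀ
  ⊢ₙ-length Unit = refl
  ⊢ₙ-length Var  = refl
  ⊢ₙ-length (Tens {Γ} {Δ} {A = A} _ M N) = begin
    length (names (Γ ++ Δ))                    ≡⟨ cong length (map-++ name Γ Δ) ⟩
    length (names Γ ++ names Δ)                ≡⟨ length-++ (names Γ) ⟩
    length (names Γ) ℕ.+ length (names Δ)      ≡⟨ cong₂ ℕ._+_ (⊢ₙ-length M) (⊢ₙ-length N) ⟩
    length ⟦ A ⟧ᵀ ℕ.+ _                        ≡⟨ length-++ ⟦ A ⟧ᵀ ⟨
    length (⟦ A ⟧ᵀ ++ _)                       ∎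
    where open ≡-Reasoning
  ⊢ₙ-length (Box {Γ} {A = A} d N) =
    trans (cong length (names-+ᶜ d Γ)) (trans (⊢ₙ-length N) (sym (length-map _ ⟦ A ⟧ᵀ)))

  -- The type dictates the constructors, and the variables occur in the order of the context, so
  -- relating the names is enough.
  ⊢ₙ-unique : ∀ {ρ Γ Γ′ t t′ A} → Γ ⊢ₙ t ∶ A → Γ′ ⊢ₙ t′ ∶ A →
              Pointwise (ρ ⊢_~_) (names Γ) (names Γ′) → ρ ⊢ t ≈α t′
  ⊢ₙ-unique Unit Unit _        = ⋆
  ⊢ₙ-unique Var  Var  (r ∷ []) = var r
  ⊢ₙ-unique {ρ} (Tens {Γ} {Δ} _ M N) (Tens {Γ′} {Δ′} _ M′ N′) rs
    -- The type of the first component fixes the length of its context, so both derivations cut at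
    -- the same place.
    with ps , qs ← Pointwise-++⁻ (names Γ) (names Γ′) (trans (⊢ₙ-length M) (sym (⊢ₙ-length M′)))
                     (subst₂ (Pointwise (ρ ⊢_~_)) (map-++ name Γ Δ) (map-++ name Γ′ Δ′) rs) =
    pair (⊢ₙ-unique M M′ ps) (⊢ₙ-unique N N′ qs)
  ⊢ₙ-unique {ρ} (Box {Γ} d N) (Box {Γ′} .d N′) rs =
    box (⊢ₙ-unique N N′ (subst₂ (Pointwise (ρ ⊢_~_)) (names-+ᶜ d Γ) (names-+ᶜ d Γ′) rs))

  -- An eliminator denotes the same morphism as its premise, so the equation passes up to the `Circ`
  -- rules, where it equates the circuits.
  ⊢ₑ-unique : ∀ {ρ Γ Γ′ u u′ A} (E : Γ ⊢ₑ u ∶ A) (E′ : Γ′ ⊢ₑ u′ ∶ A) →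
              ρ ⊢ Γ ~ᶜ Γ′ → ⟦ E ⟧ₑ ≈ ⟦ E′ ⟧ₑ → ρ ⊢ u ≈α u′
  ⊢ₑ-unique (Unit a xs δ E) (Unit a′ xs′ δ′ E′) rs eq
    with ps , decl r , qs ← ~ᶜ-split a xs a′ xs′ (λ ()) (λ ()) rs =
    let⋆ (var r) (⊢ₑ-unique E E′ (Pointwise.++⁺ ps qs)
      (≈-trans (≈-sym (⟦Unit⟧≈ a xs δ E)) (≈-trans eq (⟦Unit⟧≈ a′ xs′ δ′ E′))))
  ⊢ₑ-unique (Tens a xs δ E) (Tens a′ xs′ δ′ E′) rs eq
    with ps , decl r , qs ← ~ᶜ-split a xs a′ xs′ (λ ()) (λ ()) rs =
    letpair (var r) (⊢ₑ-unique E E′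
      (~ᶜ-bind₂ (qubitCtx a xs) (qubitCtx a′ xs′) (⊢ₑ⇒Distinct E) (⊢ₑ⇒Distinct E′) ps qs)
      (≈-trans (≈-sym (⟦Tens⟧≈ a xs δ E)) (≈-trans eq (⟦Tens⟧≈ a′ xs′ δ′ E′))))
  ⊢ₑ-unique (Box a xs δ E) (Box a′ xs′ δ′ E′) rs eq
    with ps , decl r , qs ← ~ᶜ-split a xs a′ xs′ (λ ()) (λ ()) rs =
    letbox (var r) (⊢ₑ-unique E E′
      (~ᶜ-bind (qubitCtx a xs) (qubitCtx a′ xs′) (⊢ₑ⇒Distinct E) (⊢ₑ⇒Distinct E′) ps qs)
      (≈-trans (≈-sym (⟦Box⟧≈ a xs δ E)) (≈-trans eq (⟦Box⟧≈ a′ xs′ δ′ E′))))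
  ⊢ₑ-unique {ρ} (Circ {a} {b} {xs} c δ N) (Circ {a′} {b′} {xs′} c′ δ′ N′) rs eq =
    -- Related names stay related after both are permuted by `c`; on the right `c` is then replaced
    -- by `c′`.
    ⊢ₙ-unique N N′ (subst₂ (Pointwise (ρ ⊢_~_)) (sym (names-transport c xs)) c≡c′
      (permute-Pointwise c (~ᶜ-names rs))) after c≈c′
    where
    c≈c′ : c ≈ c′
    c≈c′ = ≈-trans (≈-sym (⟦Circ⟧≈ {xs = xs} c δ N)) (≈-trans eq (⟦Circ⟧≈ {xs = xs′} c′ δ′ N′))
    names-transport : ∀ {a b} (c : a ⊸ b) xs →
                      names (qubitCtx b (transport c xs)) ≡ permute c (names (qubitCtx a xs))
    names-transport {a} {b} c xs =
      trans (names-qubitCtx b (transport c xs))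
        (trans (labels-transport c xs) (cong (permute c) (sym (names-qubitCtx a xs))))
    c≡c′ : permute c (names (qubitCtx a′ xs′)) ≡ names (qubitCtx b′ (transport c′ xs′))
    c≡c′ with refl , refl ← ≈⇒≡ c≈c′ =
      trans (permute-cong c≈c′ _ (trans (cong length (names-qubitCtx a xs′)) (length-labels xs′)))
        (sym (names-transport c′ xs′))
  -- Different eliminators would act on related declarations whose types have different heads.
  ⊢ₑ-unique (Unit a xs _ _) (Tens a′ xs′ _ _) rs _ with () ← ~ᶜ-split a xs a′ xs′ (λ ()) (λ ()) rs .proj₂ .proj₁
  ⊢ₑ-unique (Unit a xs _ _) (Box a′ xs′ _ _)  rs _ with () ← ~ᶜ-split a xs a′ xs′ (λ ()) (λ ()) rs .proj₂ .proj₁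
  ⊢ₑ-unique (Tens a xs _ _) (Unit a′ xs′ _ _) rs _ with () ← ~ᶜ-split a xs a′ xs′ (λ ()) (λ ()) rs .proj₂ .proj₁
  ⊢ₑ-unique (Tens a xs _ _) (Box a′ xs′ _ _)  rs _ with () ← ~ᶜ-split a xs a′ xs′ (λ ()) (λ ()) rs .proj₂ .proj₁
  ⊢ₑ-unique (Box a xs _ _)  (Unit a′ xs′ _ _) rs _ with () ← ~ᶜ-split a xs a′ xs′ (λ ()) (λ ()) rs .proj₂ .proj₁
  ⊢ₑ-unique (Box a xs _ _)  (Tens a′ xs′ _ _) rs _ with () ← ~ᶜ-split a xs a′ xs′ (λ ()) (λ ()) rs .proj₂ .proj₁
  ⊢ₑ-unique (Circ {a} {xs = xs} _ _ _) (Unit a′ xs′ _ _) rs _ = ~ᶜ-qubits a xs a′ xs′ (λ ()) rs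
  ⊢ₑ-unique (Circ {a} {xs = xs} _ _ _) (Tens a′ xs′ _ _) rs _ = ~ᶜ-qubits a xs a′ xs′ (λ ()) rs
  ⊢ₑ-unique (Circ {a} {xs = xs} _ _ _) (Box a′ xs′ _ _)  rs _ = ~ᶜ-qubits a xs a′ xs′ (λ ()) rs
  ⊢ₑ-unique (Unit a′ xs′ _ _) (Circ {a} {xs = xs} _ _ _) rs _ = ~ᶜ-qubits′ a xs a′ xs′ (λ ()) rs
  ⊢ₑ-unique (Tens a′ xs′ _ _) (Circ {a} {xs = xs} _ _ _) rs _ = ~ᶜ-qubits′ a xs a′ xs′ (λ ()) rs
  ⊢ₑ-unique (Box a′ xs′ _ _)  (Circ {a} {xs = xs} _ _ _) rs _ = ~ᶜ-qubits′ a xs a′ xs′ (λ ()) rs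

theorem21 : (R : OrderedAbelianGroup) (S : Signature R) →
    let open Language R S in
    ∀ {Γ : Ctx} {t : Term} {A : Type} (D : Γ ⊢ t ∶ A) →
    ∃! _≈α_ (λ u → Σ[ E ∈ Γ ⊢ₑ u ∶ A ] ⟦ D ⟧ ≈ ⟦ E ⟧ₑ)
theorem21 R S {Γ} D =
  let open Language R S
      open Normalisation R S
      -- The qubit prefix is empty at first.
      u , E , D≈E = normalise Γ [] [] (⊢⇒Distinct D) ⟦ D ⟧ refl refl
  in u , (E , D≈E) , λ (E′ , D≈E′) → ⊢ₑ-unique E E′ (~ᶜ-refl Γ) (≈-trans (≈-sym D≈E) D≈E′)
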